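{- Every $(C_4,K_{1,2})$-co-critical graph on $n\ge 5$ vertices has at least $2n-3$ edges. Moreover, this bound is sharp: for every integer $n\ge 5$ there exists a $(C_4,K_{1,2})$-co-critical graph on $n$ vertices with exactly $2n-3$ edges.
   Context: All graphs are finite, simple, without loops or multiple edges. For a graph $G$, a $\{\text{red},\text{blue}\}$-coloring of $E(G)$ is a critical coloring if $G$ contains neither a red copy of $C_4$ (the cycle on 4 vertices, as a not necessarily induced subgraph) nor a blue copy of $K_{1,2}$ (a path with 2 edges). A non-complete graph $G$ is $(C_4,K_{1,2})$-co-critical if $G$ admits a critical coloring, but for every edge $e$ of the complement of $G$, the graph $G+e$ (obtained by adding $e$) admits no critical coloring. -}

module Defs where

open import Data.Nat using (ℕ; suc; _+_; _≤_)
open import Data.Fin using (Fin; toℕ; _<_)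
open import Data.Bool using (Bool; true; false; _∨_)
open import Data.List using (List; length; filter; allFin; concatMap)
open import Data.Product using (Σ; ∃; _×_; _,_)
open import Relation.Nullary using (¬_; Dec)
open import Relation.Binary.PropositionalEquality using (_≡_; _≢_)
open import Data.Fin using (_≟_)
open import Data.Fin.Properties using (_<?_)
open import Relation.Nullary.Decidable using (⌊_⌋)
open import Data.Bool using (_∧_)
open import Data.Bool.Properties using (∧-comm; ∨-comm)
open import Relation.Nullary using (yes; no)
open import Relation.Binary.PropositionalEquality using (refl)
open import Data.Empty using (⊥-elim)

record Graph (n : ℕ) : Set where
  field
    adj   : Fin n → Fin n → Bool
    sym   : ∀ i j → adj i j ≡ adj j i
    irrefl : ∀ i → adj i i ≡ false
open Graph public

edgePairs : ∀ {n} → Graph n → List (Fin n × Fin n)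
edgePairs {n} G =
  filter (λ p → Data.Bool.T? (adjPair p))
    (concatMap (λ i → Data.List.map (λ j → (i , j)) (allFin n)) (allFin n))
  where
  adjPair : Fin n × Fin n → Bool
  adjPair (i , j) = ⌊ i <? j ⌋ ∧ adj G i j

edgeCount : ∀ {n} → Graph n → ℕ
edgeCount G = length (edgePairs G)

-- 2-edge-colorings: colour of pair (i,j); true = red, false = blue.
-- Only the values on edges matter; colours are symmetric.
record Coloring {n : ℕ} (G : Graph n) : Set where
  field
    col    : Fin n → Fin n → Bool
    colSym : ∀ i j → col i j ≡ col j i
open Coloring public

redEdge : ∀ {n} {G : Graph n} → Coloring G → Fin n → Fin n → Set
redEdge {G = G} c i j = (adj G i j ≡ true) × (col c i j ≡ true)

blueEdge : ∀ {n} {G : Graph n} → Coloring G → Fin n → Fin n → Set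
blueEdge {G = G} c i j = (adj G i j ≡ true) × (col c i j ≡ false)

HasRedC4 : ∀ {n} {G : Graph n} → Coloring G → Set
HasRedC4 {n} c = Σ (Fin n) λ a → Σ (Fin n) λ b → Σ (Fin n) λ x → Σ (Fin n) λ d →
  (a ≢ b) × (a ≢ x) × (a ≢ d) × (b ≢ x) × (b ≢ d) × (x ≢ d) ×
  redEdge c a b × redEdge c b x × redEdge c x d × redEdge c d a

HasBlueP3 : ∀ {n} {G : Graph n} → Coloring G → Set
HasBlueP3 {n} c = Σ (Fin n) λ a → Σ (Fin n) λ b → Σ (Fin n) λ x →
  (a ≢ b) × (a ≢ x) × (b ≢ x) × blueEdge c a b × blueEdge c a x

Critical : ∀ {n} {G : Graph n} → Coloring G → Set
Critical c = ¬ HasRedC4 c × ¬ HasBlueP3 c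

AdmitsCritical : ∀ {n} → Graph n → Set
AdmitsCritical G = Σ (Coloring G) Critical

addAdj : ∀ {n} → (Fin n → Fin n → Bool) → Fin n → Fin n → Fin n → Fin n → Bool
addAdj a u v i j =
  a i j ∨ ((⌊ i ≟ u ⌋ ∧ ⌊ j ≟ v ⌋) ∨ (⌊ i ≟ v ⌋ ∧ ⌊ j ≟ u ⌋))

addEdge : ∀ {n} (G : Graph n) (u v : Fin n) → u ≢ v → Graph n
addEdge {n} G u v u≢v = record { adj = addAdj (adj G) u v ; sym = s ; irrefl = ir }
  where
  s : ∀ i j → addAdj (adj G) u v i j ≡ addAdj (adj G) u v j i
  s i j rewrite sym G i j
    | ∧-comm ⌊ i ≟ u ⌋ ⌊ j ≟ v ⌋
    | ∧-comm ⌊ i ≟ v ⌋ ⌊ j ≟ u ⌋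
    | ∨-comm (⌊ j ≟ v ⌋ ∧ ⌊ i ≟ u ⌋) (⌊ j ≟ u ⌋ ∧ ⌊ i ≟ v ⌋) = refl
  ir : ∀ i → addAdj (adj G) u v i i ≡ false
  ir i rewrite irrefl G i with i ≟ u | i ≟ v
  ... | yes refl | yes refl = ⊥-elim (u≢v refl)
  ... | yes _ | no _ = refl
  ... | no _ | yes _ = refl
  ... | no _ | no _ = refl

NonComplete : ∀ {n} → Graph n → Set
NonComplete {n} G = Σ (Fin n) λ u → Σ (Fin n) λ v → (u ≢ v) × (adj G u v ≡ false)

CoCritical : ∀ {n} → Graph n → Set
CoCritical {n} G =
  NonComplete G × AdmitsCritical G ×
  (∀ u v → (u≢v : u ≢ v) → adj G u v ≡ false → ¬ AdmitsCritical (addEdge G u v u≢v))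

{-# OPTIONS --safe #-}

-- Lower bound. Take a critical colouring in which no blue edge can be recoloured red. Then its red graph R is
-- C4-free, any two vertices not adjacent in R are joined by a red path with three edges, and the set U of vertices
-- without a blue edge is a red clique, so |U| ≤ 3. Since 2 (number of blue edges) ≥ n - |U|, it suffices that
-- 3 n + |U| ≤ 2 e(R) + 7. This is proved by discharging: search R from a vertex v of degree at most 2, split each
-- edge (worth 2) between its ends in favour of the end farther from v, and check that all vertices get at least 3 but
-- for a small total defect. If v is a leaf or its two neighbours are not adjacent, the defect is 5 (6 if there are
-- three leaves), and a large U produces vertices that get more: recolouring an edge st inside U blue shows that
-- the red paths from x to s can be chosen not to pass through t. If all vertices of degree 2 lie in triangles, the
-- defect is at most 4.
--
-- Sharpness. For n ≥ 7 take the cone over a disjoint union of K2 or P3 with even cycles, for n = 5 the book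
-- with three triangular pages and for n = 6 the triangle with a further triangle on each side.
module Submission where

open import Defs renaming (sym to adj-sym; irrefl to adj-irrefl)
open import Data.Bool using (Bool; true; false; _∧_; _∨_; not; T?; if_then_else_)
import Data.Bool as Bool
open import Data.Bool.Properties using (∧-comm; ∨-comm; ∨-zeroʳ; ∧-zeroʳ; ¬-not)
open import Data.Empty using (⊥; ⊥-elim)
open import Data.Fin using (Fin; zero; suc; _≟_; _↑ˡ_; _↑ʳ_; splitAt; join)
open import Data.Fin.Patterns using (0F; 1F; 2F; 3F; 4F; 5F)
open import Data.Fin.Properties using (any?; all?; _<?_; <-cmp; suc-injective; splitAt-↑ˡ; splitAt-↑ʳ; splitAt-join; join-splitAt; ↑ˡ-injective)
open import Data.List using (List; []; _∷_; length; filter; map; concatMap; tabulate; allFin; _++_)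
open import Data.List.Properties using (filter-++; length-++; map-tabulate)
open import Data.List.Relation.Unary.All as All using (All; []; _∷_)
open import Data.List.Relation.Unary.AllPairs using ([]; _∷_)
open import Data.List.Relation.Unary.Unique.Propositional using (Unique)
open import Data.Nat using (ℕ; zero; suc; _≤_; _<_; z≤n; s≤s; _+_; _∸_; _*_; _≤?_)
import Data.Nat as ℕ
open import Data.Nat.ListAction using () renaming (sum to listSum)
open import Data.Nat.Properties hiding (_≟_; _<?_; <-cmp; suc-injective)
open import Data.Nat.Solver using (module +-*-Solver)
open import Algebra.Properties.CommutativeMonoid.Sum +-0-commutativeMonoid using (sum; sum-cong-≗; ∑-distrib-+; ∑-comm)
open import Data.Product using (Σ; ∃; _×_; _,_; proj₁; proj₂)
open import Data.Sum using (_⊎_; inj₁; inj₂; [_,_]′; swap)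
open import Data.Vec using (Vec; []; _∷_; lookup)
open import Function using (_∘_; id)
open import Relation.Binary using (tri<; tri≈; tri>)
open import Relation.Binary.PropositionalEquality using (_≡_; _≢_; refl; sym; trans; cong; cong₂; subst; ≢-sym; module ≡-Reasoning)
open import Relation.Nullary using (¬_; Dec; yes; no; ¬?)
open import Relation.Nullary.Decidable using (⌊_⌋; _×-dec_; _→-dec_; _⊎-dec_; map′; from-yes)

-- Sums over finite sets

-- The constant 7 is the largest that works. Adding 3n + |U| ≤ 2e(R) + 7 and n ≤ 2e(B) + |U|, where
-- B is the blue graph, gives 4n ≤ 2e(G) + 7, so e(G) ≥ 2n - 7/2, which integrality rounds up to 2n
-- - 3; with 8 an edge would be lost. The obstacle is the size of U. It can be 3, and defects 5 and
-- 6 would then give 8 and 9. The missing 1 or 2 comes from a property stronger than the existence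
-- of three-edge paths: a new edge xs is coloured red and st is turned blue at the same time, which
-- creates no blue path because s and t have no blue edge. Hence red paths to s exist that do not
-- end with the edge ts, and such a path shows s a further neighbour. A root in a triangle has
-- defect 4 at most, so there |U| ≤ 3 is enough; the difficulty moves to vertices at distance two
-- without a useful second neighbour, of which there is at most one.

ind : Bool → ℕ
ind true  = 1
ind false = 0

δ : ∀ {n} → Fin n → Fin n → ℕ
δ i j = ind ⌊ i ≟ j ⌋

δ-refl : ∀ {n} (i : Fin n) → δ i i ≡ 1
δ-refl i with i ≟ i
... | yes _   = refl
... | no i≢i = ⊥-elim (i≢i refl)

δ-suc : ∀ {n} (i j : Fin n) → δ (suc i) (suc j) ≡ δ i j
δ-suc i j with i ≟ j
... | yes _ = refl
... | no _  = refl

sum-zero : ∀ n → sum {n} (λ _ → 0) ≡ 0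
sum-zero zero    = refl
sum-zero (suc n) = sum-zero n

sum-const : ∀ n k → sum {n} (λ _ → k) ≡ n * k
sum-const zero    k = refl
sum-const (suc n) k = cong (k +_) (sum-const n k)

sum-mono : ∀ {n} {f g : Fin n → ℕ} → (∀ i → f i ≤ g i) → sum f ≤ sum g
sum-mono {zero}  f≤g = z≤n
sum-mono {suc n} f≤g = +-mono-≤ (f≤g zero) (sum-mono (f≤g ∘ suc))

sum-δ : ∀ {n} (i : Fin n) k → sum (λ j → k * δ i j) ≡ k
sum-δ {suc n} zero    k = begin
  k * 1 + sum {n} (λ j → k * 0)
    ≡⟨ cong₂ _+_ (*-identityʳ k) (trans (sum-cong-≗ {n} (λ _ → *-zeroʳ k)) (sum-zero n)) ⟩
  k + 0
    ≡⟨ +-identityʳ k ⟩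
  k ∎
  where open ≡-Reasoning
sum-δ {suc n} (suc i) k = begin
  k * 0 + sum (λ j → k * δ (suc i) (suc j))
    ≡⟨ cong₂ _+_ (*-zeroʳ k) (sum-cong-≗ (λ j → cong (k *_) (δ-suc i j))) ⟩
  sum (λ j → k * δ i j)
    ≡⟨ sum-δ i k ⟩
  k ∎
  where open ≡-Reasoning

sum-+δ : ∀ {n} (f : Fin n → ℕ) i k → sum (λ j → f j + k * δ i j) ≡ sum f + k
sum-+δ f i k = trans (∑-distrib-+ f (λ j → k * δ i j)) (cong (sum f +_) (sum-δ i k))

erase : ∀ {n} → Fin n → (Fin n → ℕ) → Fin n → ℕ
erase i f j = if ⌊ i ≟ j ⌋ then 0 else f j

erase-≢ : ∀ {n} {i j : Fin n} f → i ≢ j → erase i f j ≡ f j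
erase-≢ {i = i} {j} f i≢j with i ≟ j
... | yes i≡j = ⊥-elim (i≢j i≡j)
... | no _    = refl

sum-erase : ∀ {n} (f : Fin n → ℕ) i → sum f ≡ sum (erase i f) + f i
sum-erase f i = trans (sum-cong-≗ pointwise) (sum-+δ (erase i f) i (f i))
  where
  pointwise : ∀ j → f j ≡ erase i f j + f i * δ i j
  pointwise j with i ≟ j
  ... | yes refl = sym (*-identityʳ (f i))
  ... | no _     = sym (trans (cong (f j +_) (*-zeroʳ (f i))) (+-identityʳ (f j)))

sum-distinct : ∀ {n} (f : Fin n → ℕ) (ys : List (Fin n)) → Unique ys →
               listSum (map f ys) ≤ sum f
sum-distinct f []       _            = z≤n
sum-distinct f (y ∷ ys) (y∉ys ∷ uys) = begin
  f y + listSum (map f ys)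
    ≡⟨ cong (f y +_) (same ys y∉ys) ⟨
  f y + listSum (map (erase y f) ys)
    ≤⟨ +-monoʳ-≤ (f y) (sum-distinct (erase y f) ys uys) ⟩
  f y + sum (erase y f)
    ≡⟨ +-comm (f y) _ ⟩
  sum (erase y f) + f y
    ≡⟨ sum-erase f y ⟨
  sum f ∎
  where
  open ≤-Reasoning
  same : ∀ zs → All (y ≢_) zs → listSum (map (erase y f) zs) ≡ listSum (map f zs)
  same []       []           = refl
  same (z ∷ zs) (y≢z ∷ y∉zs) = cong₂ _+_ (erase-≢ f y≢z) (same zs y∉zs)

-- Names the vertices once a count such as |U| or the number of leaves is known to be large.
choose : ∀ {n} (P : Fin n → Bool) k → k ≤ sum (ind ∘ P) →
         ∃ λ ys → length ys ≡ k × Unique ys × All (λ y → P y ≡ true) ys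
choose P zero    _  = [] , refl , [] , []
choose {n} P (suc k) k< with any? (λ x → P x Bool.≟ true)
... | no none = ⊥-elim (1+n≰n (≤-trans k< (≤-trans (≤-reflexive (trans (sum-cong-≗ zeroes) (sum-zero n))) z≤n)))
  where
  zeroes : ∀ x → ind (P x) ≡ 0
  zeroes x with P x in eq
  ... | true  = ⊥-elim (none (x , eq))
  ... | false = refl
... | yes (x , Px) with choose P∖x k (+-cancelʳ-≤ 1 k _ (≤-trans (≤-reflexive (+-comm k 1)) (≤-trans k< (≤-reflexive split))))
  where
  P∖x = λ y → P y ∧ not ⌊ x ≟ y ⌋
  pointwise : ∀ y → erase x (ind ∘ P) y ≡ ind (P∖x y)
  pointwise y with x ≟ y | P y
  ... | yes _ | true  = refl
  ... | yes _ | false = refl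
  ... | no _  | true  = refl
  ... | no _  | false = refl
  split : sum (ind ∘ P) ≡ sum (ind ∘ P∖x) + 1
  split = trans (sum-erase (ind ∘ P) x) (cong₂ _+_ (sum-cong-≗ pointwise) (cong ind Px))
...   | ys , len , uys , Pys =
  x ∷ ys , cong suc len , All.map (proj₂ ∘ split∧) Pys ∷ uys , Px ∷ All.map (proj₁ ∘ split∧) Pys
  where
  split∧ : ∀ {y} → P y ∧ not ⌊ x ≟ y ⌋ ≡ true → P y ≡ true × x ≢ y
  split∧ {y} eq with P y | x ≟ y
  split∧ eq | true | no x≢y = refl , x≢y

-- Edge counts as double sums

module _ {A : Set} (f : A → Bool) where

  length-filter-tabulate : ∀ {n} (g : Fin n → A) →
    length (filter (T? ∘ f) (tabulate g)) ≡ sum (ind ∘ f ∘ g)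
  length-filter-tabulate {zero}  g = refl
  length-filter-tabulate {suc n} g with f (g zero)
  ... | true  = cong suc (length-filter-tabulate (g ∘ suc))
  ... | false = length-filter-tabulate (g ∘ suc)

  length-filter-concatMap : ∀ {m n} (h : Fin m → List A) (g : Fin n → Fin m) →
    length (filter (T? ∘ f) (concatMap h (tabulate g))) ≡ sum (λ i → length (filter (T? ∘ f) (h (g i))))
  length-filter-concatMap {n = zero}  h g = refl
  length-filter-concatMap {n = suc n} h g = begin
    length (filter (T? ∘ f) (h (g zero) ++ rest))
      ≡⟨ cong length (filter-++ (T? ∘ f) (h (g zero)) rest) ⟩
    length (filter (T? ∘ f) (h (g zero)) ++ filter (T? ∘ f) rest)
      ≡⟨ length-++ (filter (T? ∘ f) (h (g zero))) ⟩
    length (filter (T? ∘ f) (h (g zero))) + length (filter (T? ∘ f) rest)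
      ≡⟨ cong (length (filter (T? ∘ f) (h (g zero))) +_) (length-filter-concatMap h (g ∘ suc)) ⟩
    sum (λ i → length (filter (T? ∘ f) (h (g i)))) ∎
    where
    open ≡-Reasoning
    rest = concatMap h (tabulate (g ∘ suc))

length-filter-pairs : ∀ {n} (f : Fin n × Fin n → Bool) →
  length (filter (T? ∘ f) (concatMap (λ i → map (λ j → (i , j)) (allFin n)) (allFin n)))
    ≡ sum (λ i → sum (λ j → ind (f (i , j))))
length-filter-pairs {n} f =
  trans (length-filter-concatMap f (λ i → map (i ,_) (allFin n)) id)
        (sum-cong-≗ (λ i → trans (cong (length ∘ filter (T? ∘ f)) (map-tabulate id (i ,_)))
                                 (length-filter-tabulate f (i ,_))))

edgeCount-sum : ∀ {n} (G : Graph n) →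
  edgeCount G ≡ sum (λ i → sum (λ j → ind (⌊ i <? j ⌋ ∧ adj G i j)))
edgeCount-sum {n} G = length-filter-pairs {n} _

-- For a symmetric loopless relation this is the degree sum, the 2e of the inequalities; it avoids
-- the order on `Fin n` in `edgeCount`.
ends : ∀ {n} → (Fin n → Fin n → Bool) → ℕ
ends a = sum (λ i → sum (λ j → ind (a i j)))

handshake : ∀ {n} (G : Graph n) → ends (adj G) ≡ edgeCount G + edgeCount G
handshake G = begin
  ends (adj G)
    ≡⟨ sum-cong-≗ (λ i → trans (sum-cong-≗ (λ j → halves i j)) (∑-distrib-+ (up i) (λ j → up j i))) ⟩
  sum (λ i → sum (up i) + sum (λ j → up j i))
    ≡⟨ ∑-distrib-+ (λ i → sum (up i)) (λ i → sum (λ j → up j i)) ⟩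
  sum (λ i → sum (up i)) + sum (λ i → sum (λ j → up j i))
    ≡⟨ cong (sum (λ i → sum (up i)) +_) (∑-comm (λ i j → up j i)) ⟩
  sum (λ i → sum (up i)) + sum (λ i → sum (up i))
    ≡⟨ cong₂ _+_ (edgeCount-sum G) (edgeCount-sum G) ⟨
  edgeCount G + edgeCount G ∎
  where
  open ≡-Reasoning
  up = λ i j → ind (⌊ i <? j ⌋ ∧ adj G i j)
  halves : ∀ i j → ind (adj G i j) ≡ up i j + up j i
  halves i j with <-cmp i j
  ... | tri< i<j _ j≮i with i <? j | j <? i
  ...   | yes _   | no _    = sym (+-identityʳ _)
  ...   | yes _   | yes j<i = ⊥-elim (j≮i j<i)
  ...   | no i≮j  | _       = ⊥-elim (i≮j i<j)
  halves i j | tri> i≮j _ j<i with i <? j | j <? i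
  ...   | no _    | yes _   = cong ind (adj-sym G i j)
  ...   | no _    | no j≮i  = ⊥-elim (j≮i j<i)
  ...   | yes i<j | _       = ⊥-elim (i≮j i<j)
  halves i .i | tri≈ i≮i refl _ with i <? i
  ...   | yes i<i = ⊥-elim (i≮i i<i)
  ...   | no _    = cong ind (adj-irrefl G i)

-- Saturated red graphs and discharging

-- Three edges which an edge `xy` would close to a C4. Distinctness is recorded for the
-- non-consecutive pairs only; for consecutive vertices irreflexivity of the relation gives it.
record Path {n} (_~_ : Fin n → Fin n → Set) (x y : Fin n) : Set where
  field
    {p q} : Fin n
    x~p   : x ~ p
    p~q   : p ~ q
    q~y   : q ~ y
    x≢q   : x ≢ q
    p≢y   : p ≢ y

-- All that the discharging knows about the red graph. `avoid` only keeps the path from ending with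
-- the edge `ts`: its vertex `p` may be `t`. Through `third` the order of the graph enters.
record Saturated {n} (R : Fin n → Fin n → Bool) (U : Fin n → Bool) : Set where
  infix 4 _~_
  _~_ : Fin n → Fin n → Set
  x ~ y = R x y ≡ true
  field
    third   : ∀ (x y : Fin n) → ∃ λ z → z ≢ x × z ≢ y
    ~-sym   : ∀ {x y} → x ~ y → y ~ x
    ~-irr   : ∀ {x} → ¬ x ~ x
    noC4    : ∀ {a b x d} → a ≢ x → b ≢ d → a ~ b → b ~ x → x ~ d → d ~ a → ⊥
    path    : ∀ {x y} → x ≢ y → ¬ x ~ y → Path _~_ x y
    U-clique : ∀ {s t} → U s ≡ true → U t ≡ true → s ≢ t → s ~ t
    avoid   : ∀ {s t x} → U s ≡ true → U t ≡ true → s ≢ t → x ≢ s → ¬ x ~ s →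
              Σ (Path _~_ x s) λ π → Path.q π ≢ t

data Kind : Set where
  root near mid rich poor : Kind

mid? : ∀ k → Dec (k ≡ mid)
mid? root = no λ ()
mid? near = no λ ()
mid? mid  = yes refl
mid? rich = no λ ()
mid? poor = no λ ()

-- weight k l is the part, out of 2, that an end of kind k gets of an edge whose other end has kind l. The kinds
-- near and mid stand for distance 1 and 2 from the root, rich and poor for the rest: a rich vertex will have degree
-- at least 3, so it can afford to share its edges to mid vertices equally.
weight : Kind → Kind → ℕ
weight root root = 1
weight root _    = 0
weight near root = 2
weight near near = 1
weight near _    = 0
weight mid  root = 2
weight mid  near = 2
weight mid  poor = 0
weight mid  _    = 1
weight rich root = 2
weight rich near = 2
weight rich _    = 1
weight poor rich = 1
weight poor poor = 1
weight poor _    = 2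

weight-sum : ∀ k l → weight k l + weight l k ≡ 2
weight-sum root root = refl
weight-sum root near = refl
weight-sum root mid  = refl
weight-sum root rich = refl
weight-sum root poor = refl
weight-sum near root = refl
weight-sum near near = refl
weight-sum near mid  = refl
weight-sum near rich = refl
weight-sum near poor = refl
weight-sum mid  root = refl
weight-sum mid  near = refl
weight-sum mid  mid  = refl
weight-sum mid  rich = refl
weight-sum mid  poor = refl
weight-sum rich root = refl
weight-sum rich near = refl
weight-sum rich mid  = refl
weight-sum rich rich = refl
weight-sum rich poor = refl
weight-sum poor root = refl
weight-sum poor near = refl
weight-sum poor mid  = refl
weight-sum poor rich = refl
weight-sum poor poor = refl

module Weighted {n} (R : Fin n → Fin n → Bool) (R-sym : ∀ x y → R x y ≡ R y x) (w : Fin n → Fin n → ℕ) where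

  share : Fin n → ℕ
  share x = sum (λ y → ind (R x y) * w x y)

  -- The double sum is added to its transpose: each ordered adjacent pair then carries 2, so twice
  -- the total share is twice `ends R`.
  sum-share : (∀ x y → w x y + w y x ≡ 2) → sum share ≡ ends R
  sum-share w-sum = *-cancelʳ-≡ _ _ 2 (begin
    sum share * 2
      ≡⟨ double (sum share) ⟩
    sum share + sum share
      ≡⟨ cong (sum share +_) (∑-comm (λ x y → ind (R x y) * w x y)) ⟩
    sum share + sum (λ y → sum (λ x → ind (R x y) * w x y))
      ≡⟨ ∑-distrib-+ share (λ y → sum (λ x → ind (R x y) * w x y)) ⟨
    sum (λ x → share x + sum (λ y → ind (R y x) * w y x))
      ≡⟨ sum-cong-≗ (λ x → trans (sym (∑-distrib-+ (λ y → ind (R x y) * w x y) (λ y → ind (R y x) * w y x)))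
                                  (sum-cong-≗ (λ y → both x y))) ⟩
    sum (λ x → sum (λ y → ind (R x y) + ind (R x y)))
      ≡⟨ sum-cong-≗ (λ x → ∑-distrib-+ (ind ∘ R x) (ind ∘ R x)) ⟩
    sum (λ x → sum (ind ∘ R x) + sum (ind ∘ R x))
      ≡⟨ ∑-distrib-+ (λ x → sum (ind ∘ R x)) (λ x → sum (ind ∘ R x)) ⟩
    ends R + ends R
      ≡⟨ double (ends R) ⟨
    ends R * 2 ∎)
    where
    open ≡-Reasoning
    double : ∀ m → m * 2 ≡ m + m
    double m = trans (*-comm m 2) (cong (m +_) (+-identityʳ m))
    both : ∀ x y → ind (R x y) * w x y + ind (R y x) * w y x ≡ ind (R x y) + ind (R x y)
    both x y = begin
      ind (R x y) * w x y + ind (R y x) * w y x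
        ≡⟨ cong (λ b → ind (R x y) * w x y + ind b * w y x) (R-sym y x) ⟩
      ind (R x y) * w x y + ind (R x y) * w y x
        ≡⟨ *-distribˡ-+ (ind (R x y)) (w x y) (w y x) ⟨
      ind (R x y) * (w x y + w y x)
        ≡⟨ cong (ind (R x y) *_) (w-sum x y) ⟩
      ind (R x y) * 2
        ≡⟨ double (ind (R x y)) ⟩
      ind (R x y) + ind (R x y) ∎

  share-≥ : ∀ x (ys : List (Fin n × ℕ)) → Unique (map proj₁ ys) →
            All (λ yk → R x (proj₁ yk) ≡ true × proj₂ yk ≤ w x (proj₁ yk)) ys →
            listSum (map proj₂ ys) ≤ share x
  share-≥ x ys uys nbrs = ≤-trans (termwise ys nbrs) (sum-distinct _ (map proj₁ ys) uys)
    where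
    termwise : ∀ zs → All (λ yk → R x (proj₁ yk) ≡ true × proj₂ yk ≤ w x (proj₁ yk)) zs →
               listSum (map proj₂ zs) ≤ listSum (map (λ y → ind (R x y) * w x y) (map proj₁ zs))
    termwise []             []                = z≤n
    termwise ((y , k) ∷ zs) ((x~y , k≤) ∷ ps) =
      +-mono-≤ (≤-trans k≤ (≤-reflexive (sym (trans (cong (λ b → ind b * w x y) x~y) (+-identityʳ _)))))
               (termwise zs ps)

  discharge : (∀ x y → w x y + w y x ≡ 2) → ∀ {g d : Fin n → ℕ} →
              (∀ x → g x ≤ share x + d x) → sum g ≤ ends R + sum d
  discharge w-sum {g} {d} g≤ = ≤-trans (sum-mono g≤)
    (≤-reflexive (trans (∑-distrib-+ share d) (cong (_+ sum d) (sum-share w-sum))))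

module Structure {n} {R : Fin n → Fin n → Bool} {U : Fin n → Bool} (sat : Saturated R U) where
  open Saturated sat

  R-sym : ∀ x y → R x y ≡ R y x
  R-sym x y with R x y in eq | R y x in eq′
  ... | true  | true  = refl
  ... | false | false = refl
  ... | true  | false = trans (sym (~-sym eq)) eq′
  ... | false | true  = trans (sym eq) (~-sym eq′)

  infix 4 _~?_
  _~?_ : ∀ x y → Dec (x ~ y)
  x ~? y = R x y Bool.≟ true

  ~⇒≢ : ∀ {x y} → x ~ y → x ≢ y
  ~⇒≢ x~y refl = ~-irr x~y

  Leaf : Fin n → Fin n → Set
  Leaf x w = x ~ w × (∀ y → x ~ y → y ≡ w)

  Leaf? : ∀ x → Dec (∃ (Leaf x))
  Leaf? x = any? (λ w → (x ~? w) ×-dec all? (λ y → (x ~? y) →-dec (y ≟ w)))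

  leaf : Fin n → Bool
  leaf x = ⌊ Leaf? x ⌋

  leaf-independent : ∀ {l w} → Leaf l w → ∀ {x y} → l ~ x → l ~ y → ¬ x ~ y
  leaf-independent (_ , only) {x} {y} l~x l~y x~y = ~⇒≢ x~y (trans (only x l~x) (sym (only y l~y)))

  leaf⁻ : ∀ {x} → leaf x ≡ true → ∃ (Leaf x)
  leaf⁻ {x} _ with Leaf? x
  leaf⁻ _ | yes l = l

  leaf⁺ : ∀ {x} → ∃ (Leaf x) → leaf x ≡ true
  leaf⁺ {x} l with Leaf? x
  ... | yes _ = refl
  ... | no ¬l = ⊥-elim (¬l l)

  neighbour : ∀ x → ∃ (x ~_)
  neighbour x with third x x
  ... | z , z≢x , _ with x ~? z
  ...   | yes x~z = z , x~z
  ...   | no x≁z  = _ , Path.x~p (path (≢-sym z≢x) x≁z)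

  second : ∀ {x q} → x ~ q → ∃ (Leaf x) ⊎ ∃ λ y → x ~ y × y ≢ q
  second {x} {q} x~q with any? (λ y → (x ~? y) ×-dec ¬? (y ≟ q))
  ... | yes other = inj₂ other
  ... | no none   = inj₁ (q , x~q , only)
    where
    only : ∀ y → x ~ y → y ≡ q
    only y x~y with y ≟ q
    ... | yes y≡q = y≡q
    ... | no y≢q  = ⊥-elim (none (y , x~y , y≢q))

  U≤3 : sum (ind ∘ U) ≤ 3
  U≤3 with sum (ind ∘ U) ≤? 3
  ... | yes u≤3 = u≤3
  ... | no u≰3 with choose U 4 (≰⇒> u≰3)
  ...   | (a ∷ b ∷ c ∷ d ∷ []) , refl , ((a≢b ∷ a≢c ∷ a≢d ∷ []) ∷ (b≢c ∷ b≢d ∷ []) ∷ (c≢d ∷ []) ∷ _) , (Ua ∷ Ub ∷ Uc ∷ Ud ∷ []) =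
    ⊥-elim (noC4 a≢c b≢d (U-clique Ua Ub a≢b) (U-clique Ub Uc b≢c) (U-clique Uc Ud c≢d) (~-sym (U-clique Ua Ud a≢d)))

  -- If the leaves are not adjacent, the path between them has to be x, v, w, y. If they are, they
  -- form a component K2, and no path leads from `x` to a third vertex.
  leaves-linked : ∀ {x y v w} → x ≢ y → Leaf x v → Leaf y w → v ~ w
  leaves-linked {x} {y} {v} {w} x≢y (x~v , only-v) (y~w , only-w) with x ~? y
  ... | no x≁y = subst (_~ w) (only-v p x~p) (subst (p ~_) (only-w q (~-sym q~y)) p~q)
    where open Path (path x≢y x≁y)
  ... | yes x~y with third x y
  ...   | z , z≢x , z≢y = ⊥-elim (x≢q (sym (trans (only-w q (subst (_~ q) p≡y p~q)) (sym (only-w x (~-sym x~y))))))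
    where
    open Path (path (≢-sym z≢x) (λ x~z → z≢y (trans (only-v z x~z) (sym (only-v y x~y)))))
    p≡y : p ≡ y
    p≡y = trans (only-v p x~p) (sym (only-v y x~y))

  -- By `leaves-linked` the neighbours of four leaves would form a K4, which contains a C4.
  leaves≤3 : sum (ind ∘ leaf) ≤ 3
  leaves≤3 with sum (ind ∘ leaf) ≤? 3
  ... | yes l≤3 = l≤3
  ... | no l≰3 with choose leaf 4 (≰⇒> l≰3)
  ...   | (a ∷ b ∷ c ∷ d ∷ []) , refl , ((a≢b ∷ a≢c ∷ a≢d ∷ []) ∷ (b≢c ∷ b≢d ∷ []) ∷ (c≢d ∷ []) ∷ _) , (la ∷ lb ∷ lc ∷ ld ∷ []) =
    let a′ , la = leaf⁻ la ; b′ , lb = leaf⁻ lb ; c′ , lc = leaf⁻ lc ; d′ , ld = leaf⁻ ld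
    in ⊥-elim (noC4 (~⇒≢ (leaves-linked a≢c la lc)) (~⇒≢ (leaves-linked b≢d lb ld))
         (leaves-linked a≢b la lb) (leaves-linked b≢c lb lc) (leaves-linked c≢d lc ld) (~-sym (leaves-linked a≢d la ld)))

  module Search (v : Fin n) (rich? : Fin n → Bool) where

    outer : Fin n → Kind
    outer x = if rich? x then rich else poor

    data Place (x : Fin n) : Kind → Set where
      at-root : x ≡ v → Place x root
      at-near : v ~ x → Place x near
      at-mid  : ∀ p → x ≢ v → ¬ v ~ x → v ~ p → p ~ x → Place x mid
      at-far  : x ≢ v → ¬ v ~ x → (∀ p → v ~ p → ¬ p ~ x) → Place x (outer x)

    classify : ∀ x → ∃ (Place x)
    classify x with x ≟ v
    ... | yes x≡v = root , at-root x≡v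
    ... | no x≢v with v ~? x
    ...   | yes v~x = near , at-near v~x
    ...   | no v≁x with any? (λ p → (v ~? p) ×-dec (p ~? x))
    ...     | yes (p , v~p , p~x) = mid , at-mid p x≢v v≁x v~p p~x
    ...     | no none = outer x , at-far x≢v v≁x (λ p v~p p~x → none (p , v~p , p~x))

    kind : Fin n → Kind
    kind x = proj₁ (classify x)

    place : ∀ x → Place x (kind x)
    place x = proj₂ (classify x)

    -- `share` refers to the outcome of `classify`; by uniqueness any evidence for a place
    -- determines it, which is how `weigh` evaluates weights.
    place-unique : ∀ {x k l} → Place x k → Place x l → k ≡ l
    place-unique (at-root _)           (at-root _)           = refl
    place-unique (at-root refl)        (at-near v~v)         = ⊥-elim (~-irr v~v)
    place-unique (at-root x≡v)         (at-mid _ x≢v _ _ _)  = ⊥-elim (x≢v x≡v)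
    place-unique (at-root x≡v)         (at-far x≢v _ _)      = ⊥-elim (x≢v x≡v)
    place-unique (at-near v~v)         (at-root refl)        = ⊥-elim (~-irr v~v)
    place-unique (at-near _)           (at-near _)           = refl
    place-unique (at-near v~x)         (at-mid _ _ v≁x _ _)  = ⊥-elim (v≁x v~x)
    place-unique (at-near v~x)         (at-far _ v≁x _)      = ⊥-elim (v≁x v~x)
    place-unique (at-mid _ x≢v _ _ _)  (at-root x≡v)         = ⊥-elim (x≢v x≡v)
    place-unique (at-mid _ _ v≁x _ _)  (at-near v~x)         = ⊥-elim (v≁x v~x)
    place-unique (at-mid _ _ _ _ _)    (at-mid _ _ _ _ _)    = refl
    place-unique (at-mid p _ _ v~p p~x) (at-far _ _ none)    = ⊥-elim (none p v~p p~x)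
    place-unique (at-far x≢v _ _)      (at-root x≡v)         = ⊥-elim (x≢v x≡v)
    place-unique (at-far _ v≁x _)      (at-near v~x)         = ⊥-elim (v≁x v~x)
    place-unique (at-far _ _ none)     (at-mid p _ _ v~p p~x) = ⊥-elim (none p v~p p~x)
    place-unique (at-far _ _ _)        (at-far _ _ _)        = refl

    kind-≡ : ∀ {x k} → Place x k → kind x ≡ k
    kind-≡ {x} = place-unique (place x)

    open Weighted R R-sym (λ x y → weight (kind x) (kind y)) public
      using (share; share-≥) renaming (discharge to discharge′)

    discharge : ∀ {g d : Fin n → ℕ} → (∀ x → g x ≤ share x + d x) → sum g ≤ ends R + sum d
    discharge = discharge′ (λ x y → weight-sum (kind x) (kind y))

    weigh : ∀ {x y k l} → Place x k → Place y l → weight k l ≤ weight (kind x) (kind y)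
    weigh px py = ≤-reflexive (sym (cong₂ weight (kind-≡ px) (kind-≡ py)))

    -- The kind is a variable with an equation because the index `outer x` of `at-far` cannot be
    -- unified with `mid` until `rich? x` is evaluated.
    mid⁻ : ∀ {x k} → Place x k → k ≡ mid → x ≢ v × ¬ v ~ x × ∃ λ p → v ~ p × p ~ x
    mid⁻ (at-mid p x≢v v≁x v~p p~x) _ = x≢v , v≁x , p , v~p , p~x
    mid⁻ {x} (at-far _ _ _) outer≡mid with rich? x
    mid⁻ (at-far _ _ _) () | true
    mid⁻ (at-far _ _ _) () | false

    Far : Fin n → Set
    Far x = x ≢ v × ¬ v ~ x × (∀ p → v ~ p → ¬ p ~ x)

    at-far′ : ∀ {x} → Far x → Place x (outer x)
    at-far′ (x≢v , v≁x , none) = at-far x≢v v≁x none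

    -- If `q` were adjacent to `v`, then `x` would be within distance two.
    mid-on-path : ∀ {x} → Far x → (π : Path _~_ v x) → Place (Path.q π) mid
    mid-on-path (_ , _ , none) π = at-mid p (≢-sym x≢q) (λ v~q → none q v~q q~y) x~p p~q
      where open Path π

    far-neighbour : ∀ {x y} → Far x → x ~ y → Place y mid ⊎ Far y
    far-neighbour {y = y} (x≢v , v≁x , none) x~y with classify y
    ... | _ , at-root refl                = ⊥-elim (v≁x (~-sym x~y))
    ... | _ , at-near v~y                 = ⊥-elim (none y v~y (~-sym x~y))
    ... | _ , at-mid p y≢v v≁y v~p p~y    = inj₁ (at-mid p y≢v v≁y v~p p~y)
    ... | _ , at-far y≢v v≁y none′        = inj₂ (y≢v , v≁y , none′)

  -- Search from a vertex with independent neighbourhood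

  module Independent (v : Fin n) (independent : ∀ {x y} → v ~ x → v ~ y → ¬ x ~ y) where
    open Search v (λ _ → false)

    -- The end of the path is arbitrary here: `v ~ q` would make `p` and `q` adjacent neighbours of
    -- `v`.
    path-mid : ∀ {x} (π : Path _~_ v x) → Place (Path.q π) mid
    path-mid π = at-mid p (≢-sym x≢q) (λ v~q → independent x~p v~q p~q) x~p p~q
      where open Path π

    far-weight : ∀ {x y} → Far x → x ~ y → 1 ≤ weight (kind x) (kind y)
    far-weight far x~y with far-neighbour far x~y
    ... | inj₁ mid-y = ≤-trans (s≤s z≤n) (weigh (at-far′ far) mid-y)
    ... | inj₂ far-y = weigh (at-far′ far) (at-far′ far-y)

    degree : ℕ
    degree = sum (ind ∘ R v)

    -- The root gets nothing, while its neighbours and the far leaves may get only 2. So `k` is 3,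
    -- or 2 for a root that is a leaf, since then the term for leaves supplies the remaining 1.
    defect : ℕ → Fin n → ℕ
    defect k x = (ind (R v x) + ind (leaf x)) + k * δ v x

    sum-defect : ∀ k → sum (defect k) ≡ (degree + sum (ind ∘ leaf)) + k
    sum-defect k = trans (sum-+δ (λ x → ind (R v x) + ind (leaf x)) v k)
                         (cong (_+ k) (∑-distrib-+ (ind ∘ R v) (ind ∘ leaf)))

    share-defect : ∀ k → 3 ≤ ind (leaf v) + k → ∀ x → 3 ≤ share x + defect k x
    share-defect k 3≤ x = by-place (place x)
      where
      by-place : ∀ {x l} → Place x l → 3 ≤ share x + defect k x
      by-place (at-root refl) = begin
        3
          ≤⟨ 3≤ ⟩
        ind (leaf v) + k
          ≡⟨ cong (ind (leaf v) +_) (trans (cong (k *_) (δ-refl v)) (*-identityʳ k)) ⟨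
        ind (leaf v) + k * δ v v
          ≤⟨ +-monoˡ-≤ _ (m≤n+m (ind (leaf v)) (ind (R v v))) ⟩
        defect k v
          ≤⟨ m≤n+m _ (share v) ⟩
        share v + defect k v ∎
        where open ≤-Reasoning
      by-place {x} pl@(at-near v~x) = +-mono-≤
        (share-≥ x ((v , 2) ∷ []) ([] ∷ []) ((~-sym v~x , weigh pl (at-root refl)) ∷ []))
        (≤-trans (≤-reflexive (sym (cong ind v~x))) (≤-trans (m≤m+n _ (ind (leaf x))) (m≤m+n _ _)))
      -- The path from `v` reaches `x` through another mid vertex, and half of that edge is the
      -- third unit.
      by-place {x} pl@(at-mid p x≢v v≁x v~p p~x) = ≤-trans
        (share-≥ x ((p , 2) ∷ (q π , 1) ∷ []) ((p≢q ∷ []) ∷ [] ∷ [])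
          ((~-sym p~x , weigh pl (at-near v~p)) ∷ (~-sym (q~y π) , weigh pl (path-mid π)) ∷ []))
        (m≤m+n _ _)
        where
        open Path using (q; x~p; p~q; q~y)
        π = path (≢-sym x≢v) v≁x
        p≢q : p ≢ q π
        p≢q refl = independent (x~p π) v~p (p~q π)
      -- All far vertices are poor in this search: 2 comes from the mid vertex on the path and at
      -- least 1 from any second neighbour, which only a leaf lacks.
      by-place {x} pl@(at-far x≢v v≁x none) = result (second (~-sym (q~y π)))
        where
        open Path using (q; x~p; p~q; q~y)
        far = x≢v , v≁x , none
        π = path (≢-sym x≢v) v≁x
        to-q = ~-sym (q~y π) , weigh pl (path-mid π)
        result : ∃ (Leaf x) ⊎ (∃ λ y → x ~ y × y ≢ q π) → 3 ≤ share x + defect k x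
        result (inj₁ l) = +-mono-≤
          (share-≥ x ((q π , 2) ∷ []) ([] ∷ []) (to-q ∷ []))
          (≤-trans (≤-reflexive (sym (cong ind (leaf⁺ l)))) (≤-trans (m≤n+m _ (ind (R v x))) (m≤m+n _ _)))
        result (inj₂ (y , x~y , y≢q)) = ≤-trans
          (share-≥ x ((q π , 2) ∷ (y , 1) ∷ []) ((≢-sym y≢q ∷ []) ∷ [] ∷ []) (to-q ∷ (x~y , far-weight far x~y) ∷ []))
          (m≤m+n _ _)

    ends-≥ : ∀ k s j → 3 ≤ ind (leaf v) + k → 3 + j ≤ share s →
             n * 3 + j ≤ ends R + ((degree + sum (ind ∘ leaf)) + k)
    ends-≥ k s j 3≤ 3+j≤ = begin
      n * 3 + j
        ≡⟨ cong (_+ j) (sum-const n 3) ⟨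
      sum {n} (λ _ → 3) + j
        ≡⟨ sum-+δ (λ _ → 3) s j ⟨
      sum (λ x → 3 + j * δ s x)
        ≤⟨ discharge pointwise ⟩
      ends R + sum (defect k)
        ≡⟨ cong (ends R +_) (sum-defect k) ⟩
      ends R + ((degree + sum (ind ∘ leaf)) + k) ∎
      where
      open ≤-Reasoning
      pointwise : ∀ x → 3 + j * δ s x ≤ share x + defect k x
      pointwise x with s ≟ x
      ... | yes refl = ≤-trans (≤-reflexive (cong (3 +_) (*-identityʳ j))) (≤-trans 3+j≤ (m≤m+n _ _))
      ... | no _     = ≤-trans (≤-reflexive (cong (3 +_) (*-zeroʳ j))) (share-defect k 3≤ x)

    module _ {s t r} (Us : U s ≡ true) (Ut : U t ≡ true) (Ur : U r ≡ true)
             (s≢t : s ≢ t) (s≢r : s ≢ r) (t≢r : t ≢ r) where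

      -- A path avoiding `t` at its end gives a mid neighbour `q`. If `q` is not `r`, the neighbours
      -- `q`, `t`, `r` are worth 2 + 1 + 1. If it is, then `r` is mid, and a path avoiding `r` gives
      -- a second mid neighbour: 2 + 2.
      U-far : Far s → 4 ≤ share s
      U-far far@(s≢v , v≁s , _) with avoid Us Ut s≢t (≢-sym s≢v) v≁s
      ... | π , q≢t with Path.q π ≟ r
      ...   | no q≢r =
        share-≥ s ((Path.q π , 2) ∷ (t , 1) ∷ (r , 1) ∷ []) ((q≢t ∷ q≢r ∷ []) ∷ (t≢r ∷ []) ∷ [] ∷ [])
          ((~-sym (Path.q~y π) , weigh (at-far′ far) (path-mid π)) ∷ (s~t , far-weight far s~t) ∷ (s~r , far-weight far s~r) ∷ [])
        where
        s~t = U-clique Us Ut s≢t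
        s~r = U-clique Us Ur s≢r
      ...   | yes refl with avoid Us Ur s≢r (≢-sym s≢v) v≁s
      ...     | π′ , q′≢r =
        share-≥ s ((Path.q π′ , 2) ∷ (r , 2) ∷ []) ((q′≢r ∷ []) ∷ [] ∷ [])
          ((~-sym (Path.q~y π′) , weigh (at-far′ far) (path-mid π′)) ∷ (~-sym (Path.q~y π) , weigh (at-far′ far) (path-mid π)) ∷ [])

    -- The near neighbour is worth 2, and the mid neighbours `q` and `t` are worth 1 each; `avoid`
    -- is what makes them different.
    U-mid : ∀ {s t} → U s ≡ true → U t ≡ true → s ≢ t → Place s mid → Place t mid → 4 ≤ share s
    U-mid {s} {t} Us Ut s≢t pl@(at-mid p s≢v v≁s v~p p~s) pl′@(at-mid _ _ v≁t _ _) with avoid Us Ut s≢t (≢-sym s≢v) v≁s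
    ... | π , q≢t =
      share-≥ s ((p , 2) ∷ (Path.q π , 1) ∷ (t , 1) ∷ []) ((p≢q ∷ p≢t ∷ []) ∷ (q≢t ∷ []) ∷ [] ∷ [])
        ((~-sym p~s , weigh pl (at-near v~p)) ∷ (~-sym (Path.q~y π) , weigh pl (path-mid π)) ∷ (U-clique Us Ut s≢t , weigh pl pl′) ∷ [])
      where
      p≢q : p ≢ Path.q π
      p≢q refl = independent (Path.x~p π) v~p (Path.p~q π)
      p≢t : p ≢ t
      p≢t refl = v≁t v~p

    -- The triangle `s`, `t`, `r` cannot contain the root or two of its neighbours, as the
    -- neighbourhood of `v` is independent. So one of the three is far or two of them are mid.
    surplus : ∀ {s t r} → U s ≡ true → U t ≡ true → U r ≡ true → s ≢ t → s ≢ r → t ≢ r → ∃ λ x → 4 ≤ share x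
    surplus {s} {t} {r} Us Ut Ur s≢t s≢r t≢r with classify s | classify t | classify r
    ... | _ , at-far a b c | _ | _ = s , U-far Us Ut Ur s≢t s≢r t≢r (a , b , c)
    ... | _ | _ , at-far a b c | _ = t , U-far Ut Us Ur (≢-sym s≢t) t≢r s≢r (a , b , c)
    ... | _ | _ | _ , at-far a b c = r , U-far Ur Us Ut (≢-sym s≢r) (≢-sym t≢r) s≢t (a , b , c)
    ... | _ , ps@(at-mid _ _ _ _ _) | _ , pt@(at-mid _ _ _ _ _) | _ = s , U-mid Us Ut s≢t ps pt
    ... | _ , ps@(at-mid _ _ _ _ _) | _ | _ , pr@(at-mid _ _ _ _ _) = s , U-mid Us Ur s≢r ps pr
    ... | _ | _ , pt@(at-mid _ _ _ _ _) | _ , pr@(at-mid _ _ _ _ _) = t , U-mid Ut Ur t≢r pt pr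
    ... | _ , at-root refl | _ | _ = ⊥-elim (independent (U-clique Us Ut s≢t) (U-clique Us Ur s≢r) (U-clique Ut Ur t≢r))
    ... | _ | _ , at-root refl | _ = ⊥-elim (independent (U-clique Ut Us (≢-sym s≢t)) (U-clique Ut Ur t≢r) (U-clique Us Ur s≢r))
    ... | _ | _ | _ , at-root refl = ⊥-elim (independent (U-clique Ur Us (≢-sym s≢r)) (U-clique Ur Ut (≢-sym t≢r)) (U-clique Us Ut s≢t))
    ... | _ , at-near v~s | _ , at-near v~t | _ = ⊥-elim (independent v~s v~t (U-clique Us Ut s≢t))
    ... | _ , at-near v~s | _ | _ , at-near v~r = ⊥-elim (independent v~s v~r (U-clique Us Ur s≢r))
    ... | _ | _ , at-near v~t | _ , at-near v~r = ⊥-elim (independent v~t v~r (U-clique Ut Ur t≢r))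

    -- A defect of 5 is allowed: each vertex of U beyond the second is paid for by the surplus.
    bound : ∀ k → 3 ≤ ind (leaf v) + k → (degree + sum (ind ∘ leaf)) + k ≤ 5 → n * 3 + sum (ind ∘ U) ≤ ends R + 7
    bound k 3≤ ≤5 with sum (ind ∘ U) ≤? 2
    ... | yes u≤2 = begin
      n * 3 + sum (ind ∘ U)
        ≤⟨ +-mono-≤ (≤-trans (≤-reflexive (sym (sum-const n 3))) (discharge (share-defect k 3≤))) u≤2 ⟩
      (ends R + sum (defect k)) + 2
        ≤⟨ +-monoˡ-≤ 2 (+-monoʳ-≤ (ends R) (≤-trans (≤-reflexive (sum-defect k)) ≤5)) ⟩
      (ends R + 5) + 2
        ≡⟨ +-assoc (ends R) 5 2 ⟩
      ends R + 7 ∎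
      where open ≤-Reasoning
    ... | no u≰2 with choose U 3 (≰⇒> u≰2)
    ...   | (s ∷ t ∷ r ∷ []) , refl , ((s≢t ∷ s≢r ∷ []) ∷ (t≢r ∷ []) ∷ _) , (Us ∷ Ut ∷ Ur ∷ []) with surplus Us Ut Ur s≢t s≢r t≢r
    ...     | x , 4≤ = begin
      n * 3 + sum (ind ∘ U)
        ≤⟨ +-monoʳ-≤ (n * 3) U≤3 ⟩
      n * 3 + (1 + 2)
        ≡⟨ +-assoc (n * 3) 1 2 ⟨
      (n * 3 + 1) + 2
        ≤⟨ +-monoˡ-≤ 2 (≤-trans (ends-≥ k x 1 3≤ 4≤) (+-monoʳ-≤ (ends R) ≤5)) ⟩
      (ends R + 5) + 2
        ≡⟨ +-assoc (ends R) 5 2 ⟩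
      ends R + 7 ∎
      where open ≤-Reasoning

-- Leaves

module Leaves {n} {R : Fin n → Fin n → Bool} {U : Fin n → Bool} (sat : Saturated R U) where
  open Saturated sat
  open Structure sat

  -- The supports form a triangle. `rotate` and `mirror` generate all permutations of the indices,
  -- so each fact is proved for one choice of them.
  record ThreeLeaves (l₁ l₂ l₃ w₁ w₂ w₃ : Fin n) : Set where
    field
      l₁≢l₂ : l₁ ≢ l₂
      l₁≢l₃ : l₁ ≢ l₃
      l₂≢l₃ : l₂ ≢ l₃
      leaf₁ : Leaf l₁ w₁
      leaf₂ : Leaf l₂ w₂
      leaf₃ : Leaf l₃ w₃

    w₁~w₂ : w₁ ~ w₂
    w₁~w₂ = leaves-linked l₁≢l₂ leaf₁ leaf₂
    w₁~w₃ : w₁ ~ w₃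
    w₁~w₃ = leaves-linked l₁≢l₃ leaf₁ leaf₃
    w₂~w₃ : w₂ ~ w₃
    w₂~w₃ = leaves-linked l₂≢l₃ leaf₂ leaf₃

  rotate : ∀ {l₁ l₂ l₃ w₁ w₂ w₃} → ThreeLeaves l₁ l₂ l₃ w₁ w₂ w₃ → ThreeLeaves l₂ l₃ l₁ w₂ w₃ w₁
  rotate L = record { l₁≢l₂ = l₂≢l₃ ; l₁≢l₃ = ≢-sym l₁≢l₂ ; l₂≢l₃ = ≢-sym l₁≢l₃ ; leaf₁ = leaf₂ ; leaf₂ = leaf₃ ; leaf₃ = leaf₁ }
    where open ThreeLeaves L

  mirror : ∀ {l₁ l₂ l₃ w₁ w₂ w₃} → ThreeLeaves l₁ l₂ l₃ w₁ w₂ w₃ → ThreeLeaves l₁ l₃ l₂ w₁ w₃ w₂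
  mirror L = record { l₁≢l₂ = l₁≢l₃ ; l₁≢l₃ = l₁≢l₂ ; l₂≢l₃ = ≢-sym l₂≢l₃ ; leaf₁ = leaf₁ ; leaf₂ = leaf₃ ; leaf₃ = leaf₂ }
    where open ThreeLeaves L

  module _ {s t} (Us : U s ≡ true) (Ut : U t ≡ true) (s≢t : s ≢ t) where

    -- Suppose `w ~ s`. The path from `l` to `s` passes through `w` and some `m` other than `t`. If
    -- `w ~ t`, then w, m, s, t is a C4; otherwise the path from `l` to `t` gives `m′` other than
    -- `s`, and w, s, t, m′ is one.
    support-avoids : ∀ {l w} → Leaf l w → l ≢ s → l ≢ t → w ≢ s → w ≢ t → ¬ w ~ s
    support-avoids {l} {w} (_ , only) l≢s l≢t w≢s w≢t w~s
      with avoid Us Ut s≢t l≢s (λ l~s → w≢s (sym (only s l~s)))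
    ... | π , m≢t with w ~? t
    ...   | yes w~t = noC4 w≢s m≢t (subst (_~ q) (only p x~p) p~q) q~y (U-clique Us Ut s≢t) (~-sym w~t)
      where open Path π
    ...   | no w≁t with avoid Ut Us (≢-sym s≢t) l≢t (λ l~t → w≢t (sym (only t l~t)))
    ...     | π′ , m′≢s = noC4 w≢t (≢-sym m′≢s) w~s (U-clique Us Ut s≢t) (~-sym q~y) (~-sym (subst (_~ q) (only p x~p) p~q))
      where open Path π′

    -- `w₂` is adjacent to the support `s`, which `support-avoids` forbids for a vertex other than
    -- `t`.
    support-swap : ∀ {l₁ l₂ l₃ w₂ w₃} → ThreeLeaves l₁ l₂ l₃ s w₂ w₃ → w₂ ≡ t
    support-swap {l₂ = l₂} {w₂ = w₂} L with w₂ ≟ t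
    ... | yes w₂≡t = w₂≡t
    ... | no w₂≢t = ⊥-elim (support-avoids leaf₂ l₂≢s l₂≢t (≢-sym (~⇒≢ w₁~w₂)) w₂≢t (~-sym w₁~w₂))
      where
      open ThreeLeaves L
      only = proj₂ leaf₂
      l₂≢s : l₂ ≢ s
      l₂≢s refl = ~⇒≢ w₂~w₃ (sym (only _ w₁~w₃))
      l₂≢t : l₂ ≢ t
      l₂≢t refl = ~⇒≢ w₁~w₂ (only s (U-clique Ut Us (≢-sym s≢t)))

    -- Otherwise the other two supports would both be `t`, although they are adjacent.
    support∉U : ∀ {l₁ l₂ l₃ w₁ w₂ w₃} → ThreeLeaves l₁ l₂ l₃ w₁ w₂ w₃ → w₁ ≢ s
    support∉U L refl = ~⇒≢ (ThreeLeaves.w₂~w₃ L) (trans (support-swap L) (sym (support-swap (mirror L))))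

  leaf∉U : ∀ {s t} → U s ≡ true → U t ≡ true → s ≢ t →
           ∀ {l₁ l₂ l₃ w₁ w₂ w₃} → ThreeLeaves l₁ l₂ l₃ w₁ w₂ w₃ → l₁ ≢ s
  leaf∉U {t = t} Us Ut s≢t L refl =
    support∉U Ut Us (≢-sym s≢t) L (sym (proj₂ (ThreeLeaves.leaf₁ L) t (U-clique Us Ut s≢t)))

  module _ {s t} (Us : U s ≡ true) (Ut : U t ≡ true) (s≢t : s ≢ t) where

    support≁U : ∀ {l₁ l₂ l₃ w₁ w₂ w₃} → ThreeLeaves l₁ l₂ l₃ w₁ w₂ w₃ → ¬ w₁ ~ s
    support≁U L = support-avoids Us Ut s≢t (ThreeLeaves.leaf₁ L)
      (leaf∉U Us Ut s≢t L) (leaf∉U Ut Us (≢-sym s≢t) L) (support∉U Us Ut s≢t L) (support∉U Ut Us (≢-sym s≢t) L)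

    middle : ∀ {l₁ l₂ l₃ w₁ w₂ w₃} → ThreeLeaves l₁ l₂ l₃ w₁ w₂ w₃ → ∃ λ m → w₁ ~ m × m ~ s × m ≢ t
    middle L with avoid Us Ut s≢t (leaf∉U Us Ut s≢t L)
                     (λ l~s → support∉U Us Ut s≢t L (sym (proj₂ (ThreeLeaves.leaf₁ L) s l~s)))
    ... | π , m≢t = q , subst (_~ q) (proj₂ (ThreeLeaves.leaf₁ L) p x~p) p~q , q~y , m≢t
      where open Path π

    -- A common `m` is not `w₃`, since supports are not adjacent to `s`; so w₁, m, w₂, w₃ would be a
    -- C4.
    middle-distinct : ∀ {l₁ l₂ l₃ w₁ w₂ w₃ m} → ThreeLeaves l₁ l₂ l₃ w₁ w₂ w₃ →
                      m ~ s → w₁ ~ m → ¬ w₂ ~ m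
    middle-distinct {w₃ = w₃} {m} L m~s w₁~m w₂~m with m ≟ w₃
    ... | yes refl = support≁U (rotate (rotate L)) m~s
    ... | no m≢w₃  = noC4 (~⇒≢ w₁~w₂) m≢w₃ w₁~m (~-sym w₂~m) w₂~w₃ (~-sym w₁~w₃)
      where open ThreeLeaves L

    module _ {l₁ l₂ l₃ w₁ w₂ w₃} (L : ThreeLeaves l₁ l₂ l₃ w₁ w₂ w₃) where
      open ThreeLeaves L

      open Independent l₁ (leaf-independent leaf₁)
      open Search l₁ (λ _ → false)

      -- Each support reaches `s` through its own middle vertex, and `t` is a fourth neighbour of
      -- `s`. Seen from `l₁`, the vertex `m₁` is at distance two and worth 2, the others at least 1.
      share-U : 5 ≤ share s
      share-U with middle L | middle (rotate L) | middle (rotate (rotate L))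
      ... | m₁ , w₁~m₁ , m₁~s , m₁≢t | m₂ , w₂~m₂ , m₂~s , m₂≢t | m₃ , w₃~m₃ , m₃~s , m₃≢t =
        share-≥ s ((m₁ , 2) ∷ (m₂ , 1) ∷ (m₃ , 1) ∷ (t , 1) ∷ [])
          ((m₁≢m₂ ∷ m₁≢m₃ ∷ m₁≢t ∷ []) ∷ (m₂≢m₃ ∷ m₂≢t ∷ []) ∷ (m₃≢t ∷ []) ∷ [] ∷ [])
          ((~-sym m₁~s , weigh (at-far′ far) (at-mid w₁ (λ { refl → l₁≁s m₁~s }) l₁≁m₁ (proj₁ leaf₁) w₁~m₁))
          ∷ nbr (~-sym m₂~s) ∷ nbr (~-sym m₃~s) ∷ nbr (U-clique Us Ut s≢t) ∷ [])
        where
        l₁≁s : ¬ l₁ ~ s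
        l₁≁s l~s = support∉U Us Ut s≢t L (sym (proj₂ leaf₁ s l~s))
        far : Far s
        far = ≢-sym (leaf∉U Us Ut s≢t L) , l₁≁s ,
              λ p l~p p~s → support≁U L (subst (_~ s) (proj₂ leaf₁ p l~p) p~s)
        l₁≁m₁ : ¬ l₁ ~ m₁
        l₁≁m₁ l~m = ~⇒≢ w₁~m₁ (sym (proj₂ leaf₁ m₁ l~m))
        nbr : ∀ {y} → s ~ y → s ~ y × 1 ≤ weight (kind s) (kind y)
        nbr s~y = s~y , far-weight far s~y
        m₁≢m₂ : m₁ ≢ m₂
        m₁≢m₂ refl = middle-distinct L m₁~s w₁~m₁ w₂~m₂
        m₂≢m₃ : m₂ ≢ m₃
        m₂≢m₃ refl = middle-distinct (rotate L) m₂~s w₂~m₂ w₃~m₃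
        m₁≢m₃ : m₁ ≢ m₃
        m₁≢m₃ refl = middle-distinct (rotate (rotate L)) m₁~s w₃~m₃ w₁~m₁

  leaf-degree : ∀ {l w} → Leaf l w → sum (ind ∘ R l) ≤ 1
  leaf-degree {l} {w} (_ , only) = ≤-trans (sum-mono pointwise) (≤-reflexive (sum-δ w 1))
    where
    pointwise : ∀ x → ind (R l x) ≤ 1 * δ w x
    pointwise x with R l x in eq
    ... | false = z≤n
    ... | true  = ≤-reflexive (sym (trans (+-identityʳ _) (trans (cong (δ w) (only x eq)) (δ-refl w))))

  -- With at most two leaves the defect is at most 1 + 2 + 2 = 5. With three it is at most 6, which
  -- suits |U| ≤ 1; for larger U the surplus 2 from `share-U` covers |U| ≤ 3.
  bound-leaf : ∀ {l w} → Leaf l w → n * 3 + sum (ind ∘ U) ≤ ends R + 7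
  bound-leaf {l} {w} Ll with sum (ind ∘ leaf) ≤? 2
  ... | yes λ≤2 = Independent.bound l (leaf-independent Ll) 2
    (+-monoˡ-≤ 2 (≤-reflexive (sym (cong ind (leaf⁺ (w , Ll))))))
    (+-monoˡ-≤ 2 (+-mono-≤ (leaf-degree Ll) λ≤2))
  ... | no λ≰2 with choose leaf 3 (≰⇒> λ≰2)
  ...   | (l₁ ∷ l₂ ∷ l₃ ∷ []) , refl , ((l₁≢l₂ ∷ l₁≢l₃ ∷ []) ∷ (l₂≢l₃ ∷ []) ∷ _) , (leaf₁ ∷ leaf₂ ∷ leaf₃ ∷ []) = result
    where
    L : ThreeLeaves l₁ l₂ l₃ _ _ _
    L = record { l₁≢l₂ = l₁≢l₂ ; l₁≢l₃ = l₁≢l₃ ; l₂≢l₃ = l₂≢l₃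
               ; leaf₁ = proj₂ (leaf⁻ leaf₁) ; leaf₂ = proj₂ (leaf⁻ leaf₂) ; leaf₃ = proj₂ (leaf⁻ leaf₃) }
    open ThreeLeaves L using () renaming (leaf₁ to L₁)
    open Independent l₁ (leaf-independent L₁)
    open Search l₁ (λ _ → false)
    defect≤6 : (degree + sum (ind ∘ leaf)) + 2 ≤ 6
    defect≤6 = +-monoˡ-≤ 2 (+-mono-≤ (leaf-degree L₁) leaves≤3)
    3≤ : 3 ≤ ind (leaf l₁) + 2
    3≤ = +-monoˡ-≤ 2 (≤-reflexive (sym (cong ind leaf₁)))
    open ≤-Reasoning
    result : n * 3 + sum (ind ∘ U) ≤ ends R + 7
    result with sum (ind ∘ U) ≤? 1
    ... | yes u≤1 = begin
      n * 3 + sum (ind ∘ U)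
        ≤⟨ +-mono-≤ (≤-trans (≤-reflexive (sym (sum-const n 3))) (discharge (share-defect 2 3≤))) u≤1 ⟩
      (ends R + sum (defect 2)) + 1
        ≤⟨ +-monoˡ-≤ 1 (+-monoʳ-≤ (ends R) (≤-trans (≤-reflexive (sum-defect 2)) defect≤6)) ⟩
      (ends R + 6) + 1
        ≡⟨ +-assoc (ends R) 6 1 ⟩
      ends R + 7 ∎
    ... | no u≰1 with choose U 2 (≰⇒> u≰1)
    ...   | (s ∷ t ∷ []) , refl , ((s≢t ∷ []) ∷ _) , (Us ∷ Ut ∷ []) = begin
      n * 3 + sum (ind ∘ U)
        ≤⟨ +-monoʳ-≤ (n * 3) U≤3 ⟩
      n * 3 + (2 + 1)
        ≡⟨ +-assoc (n * 3) 2 1 ⟨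
      (n * 3 + 2) + 1
        ≤⟨ +-monoˡ-≤ 1 (≤-trans (ends-≥ 2 s 2 3≤ (share-U Us Ut s≢t L)) (+-monoʳ-≤ (ends R) defect≤6)) ⟩
      (ends R + 6) + 1
        ≡⟨ +-assoc (ends R) 6 1 ⟩
      ends R + 7 ∎

-- Minimum degree at least two

module NoLeaves {n} {R : Fin n → Fin n → Bool} {U : Fin n → Bool} (sat : Saturated R U)
                (no-leaf : ∀ x → ¬ ∃ (Structure.Leaf sat x)) where
  open Saturated sat
  open Structure sat

  another : ∀ {x q} → x ~ q → ∃ λ y → x ~ y × y ≢ q
  another {x} x~q with second x~q
  ... | inj₁ l = ⊥-elim (no-leaf x l)
  ... | inj₂ y = y

  Two : Fin n → Fin n → Fin n → Set
  Two x a b = x ~ a × x ~ b × a ≢ b × (∀ y → x ~ y → y ≡ a ⊎ y ≡ b)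

  Three : Fin n → Set
  Three x = ∃ λ a → ∃ λ b → ∃ λ c → (x ~ a × x ~ b × x ~ c) × (a ≢ b × a ≢ c × b ≢ c)

  shape : ∀ x → (∃ λ a → ∃ λ b → Two x a b) ⊎ Three x
  shape x with neighbour x
  ... | a , x~a with another x~a
  ...   | b , x~b , b≢a with any? (λ c → (x ~? c) ×-dec ¬? (c ≟ a) ×-dec ¬? (c ≟ b))
  ...     | yes (c , x~c , c≢a , c≢b) = inj₂ (a , b , c , (x~a , x~b , x~c) , (≢-sym b≢a , ≢-sym c≢a , ≢-sym c≢b))
  ...     | no none = inj₁ (a , b , x~a , x~b , ≢-sym b≢a , only)
    where
    only : ∀ y → x ~ y → y ≡ a ⊎ y ≡ b
    only y x~y with y ≟ a | y ≟ b
    ... | yes y≡a | _       = inj₁ y≡a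
    ... | no _    | yes y≡b = inj₂ y≡b
    ... | no y≢a  | no y≢b  = ⊥-elim (none (y , x~y , y≢a , y≢b))

  Two? : ∀ x a b → Dec (Two x a b)
  Two? x a b = (x ~? a) ×-dec (x ~? b) ×-dec ¬? (a ≟ b) ×-dec all? (λ y → (x ~? y) →-dec ((y ≟ a) ⊎-dec (y ≟ b)))

  Two-at : ∀ {x a b p} → Two x a b → x ~ p → ∃ (Two x p)
  Two-at {p = p} (x~a , x~b , a≢b , only) x~p with only p x~p
  ... | inj₁ refl = _ , x~a , x~b , a≢b , only
  ... | inj₂ refl = _ , x~b , x~a , ≢-sym a≢b , (λ y x~y → swap (only y x~y))

  -- The defect is at most 2 + 0 + 3: two neighbours of the root, no leaves, and the root.
  bound-nonadjacent : ∀ {v a b} → Two v a b → ¬ a ~ b → n * 3 + sum (ind ∘ U) ≤ ends R + 7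
  bound-nonadjacent {v} {a} {b} (v~a , v~b , a≢b , only) a≁b = Independent.bound v independent 3
    (m≤n+m 3 _) (+-monoˡ-≤ 3 (+-mono-≤ degree≤2 (≤-reflexive (trans (sum-cong-≗ no-leaves) (sum-zero n)))))
    where
    independent : ∀ {x y} → v ~ x → v ~ y → ¬ x ~ y
    independent {x} {y} v~x v~y x~y with only x v~x | only y v~y
    ... | inj₁ refl | inj₁ refl = ~-irr x~y
    ... | inj₁ refl | inj₂ refl = a≁b x~y
    ... | inj₂ refl | inj₁ refl = a≁b (~-sym x~y)
    ... | inj₂ refl | inj₂ refl = ~-irr x~y
    no-leaves : ∀ x → ind (leaf x) ≡ 0
    no-leaves x with Leaf? x
    ... | yes l = ⊥-elim (no-leaf x l)
    ... | no _  = refl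
    pointwise : ∀ x → ind (R v x) ≤ 1 * δ a x + 1 * δ b x
    pointwise x with R v x in eq
    ... | false = z≤n
    ... | true with only x eq
    ...   | inj₁ refl = ≤-trans (≤-reflexive (sym (cong (1 *_) (δ-refl x)))) (m≤m+n _ _)
    ...   | inj₂ refl = ≤-trans (≤-reflexive (sym (cong (1 *_) (δ-refl x)))) (m≤n+m _ (1 * δ a x))
    degree≤2 : sum (ind ∘ R v) ≤ 2
    degree≤2 = ≤-trans (sum-mono pointwise)
      (≤-reflexive (trans (∑-distrib-+ (λ x → 1 * δ a x) (λ x → 1 * δ b x)) (cong₂ _+_ (sum-δ a 1) (sum-δ b 1))))

  bound-cubic : (∀ x → Three x) → n * 3 + sum (ind ∘ U) ≤ ends R + 7
  bound-cubic three = +-mono-≤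
    (≤-trans (≤-reflexive (sym (sum-const n 3)))
      (≤-trans (discharge (λ _ _ → refl) {d = λ _ → 0} share≥3)
        (≤-reflexive (trans (cong (ends R +_) (sum-zero n)) (+-identityʳ (ends R))))))
    (≤-trans U≤3 (s≤s (s≤s (s≤s z≤n))))
    where
    open Weighted R R-sym (λ _ _ → 1)
    share≥3 : ∀ x → 3 ≤ share x + 0
    share≥3 x with three x
    ... | a , b , c , (x~a , x~b , x~c) , (a≢b , a≢c , b≢c) = ≤-trans
      (share-≥ x ((a , 1) ∷ (b , 1) ∷ (c , 1) ∷ []) ((a≢b ∷ a≢c ∷ []) ∷ (b≢c ∷ []) ∷ [] ∷ [])
        ((x~a , ≤-refl) ∷ (x~b , ≤-refl) ∷ (x~c , ≤-refl) ∷ []))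
      (m≤m+n _ 0)

  -- Degree-two vertices with adjacent neighbours

  module Triangles (triangle : ∀ {x a b} → Two x a b → a ~ b) {v a b : Fin n} (Tv : Two v a b) where

    many : Fin n → Bool
    many x = [ (λ _ → false) , (λ _ → true) ]′ (shape x)

    open Search v many

    far-shape : ∀ {x} → Far x → Place x rich × Three x ⊎ Place x poor × (∃ λ c → ∃ λ d → Two x c d)
    far-shape {x} far with at-far′ far
    ... | pl with shape x
    ...   | inj₁ two   = inj₂ (pl , two)
    ...   | inj₂ three = inj₁ (pl , three)

    far-weight : ∀ {x y} → Far x → x ~ y → 1 ≤ weight (kind x) (kind y)
    far-weight far-x x~y with far-shape far-x | far-neighbour far-x x~y
    ... | inj₁ (px , _) | inj₁ py = weigh px py
    ... | inj₂ (px , _) | inj₁ py = ≤-trans (s≤s z≤n) (weigh px py)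
    ... | px | inj₂ far-y with px | far-shape far-y
    ...   | inj₁ (px , _) | inj₁ (py , _) = weigh px py
    ...   | inj₁ (px , _) | inj₂ (py , _) = weigh px py
    ...   | inj₂ (px , _) | inj₁ (py , _) = weigh px py
    ...   | inj₂ (px , _) | inj₂ (py , _) = weigh px py

    -- Among the kinds in this search outside the root and its neighbours, weight 1 singles out
    -- `mid` and `rich`. A mid vertex has 2 from a neighbour of the root and needs one such
    -- neighbour for its third unit.
    Good : Fin n → Set
    Good p = ∃ λ y → p ~ y × weight mid (kind y) ≡ 1

    Good? : ∀ p → Dec (Good p)
    Good? p = any? (λ y → (p ~? y) ×-dec (weight mid (kind y) ℕ.≟ 1))

    Bad : Fin n → Set
    Bad p = kind p ≡ mid × ¬ Good p

    Bad? : ∀ p → Dec (Bad p)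
    Bad? p = mid? (kind p) ×-dec ¬? (Good? p)

    bad-mid : ∀ {p} → Bad p → Place p mid
    bad-mid {p} (kind≡mid , _) = subst (Place p) kind≡mid (place p)

    good : ∀ {p y k} → p ~ y → Place y k → weight mid k ≡ 1 → Good p
    good {y = y} p~y py eq = y , p~y , trans (cong (weight mid) (kind-≡ py)) eq

    record Pendant (p x y : Fin n) : Set where
      field
        p~x    : p ~ x
        p~y    : p ~ y
        x-poor : Place x poor
        y-poor : Place y poor
        x-only : ∀ z → x ~ z → z ≡ p ⊎ z ≡ y
        y-only : ∀ z → y ~ z → z ≡ p ⊎ z ≡ x

    -- A further neighbour `x` of `p` is not near (that would give a C4 through `v`) and not mid or
    -- rich, so it is poor. Having degree two it lies in a triangle with `p` and some `y`, and `y`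
    -- is poor for the same reasons.
    pendant : ∀ {p} → Bad p → ∃ λ x → ∃ λ y → Pendant p x y
    pendant {p} (kind≡mid , bad) with mid⁻ (place p) kind≡mid
    ... | p≢v , v≁p , c , v~c , c~p with another (~-sym c~p)
    ...   | x , p~x , x≢c with classify x
    ...   | _ , at-root refl = ⊥-elim (v≁p (~-sym p~x))
    ...   | _ , at-near v~x = ⊥-elim (noC4 (≢-sym p≢v) (≢-sym x≢c) v~c c~p p~x (~-sym v~x))
    ...   | _ , px@(at-mid _ _ _ _ _) = ⊥-elim (bad (good p~x px refl))
    ...   | _ , at-far x≢v v≁x none with far-shape (x≢v , v≁x , none)
    ...     | inj₁ (px , _) = ⊥-elim (bad (good p~x px refl))
    ...     | inj₂ (px , _ , _ , Tx) with Two-at Tx (~-sym p~x)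
    ...       | y , Tx′@(_ , x~y , _ , x-only) with far-neighbour (x≢v , v≁x , none) x~y | triangle Tx′
    ...         | inj₁ py | p~y = ⊥-elim (bad (good p~y py refl))
    ...         | inj₂ far-y | p~y with far-shape far-y
    ...           | inj₁ (py , _) = ⊥-elim (bad (good p~y py refl))
    ...           | inj₂ (py , _ , _ , Ty) with Two-at Ty (~-sym p~y)
    ...             | z , (_ , _ , _ , y-only) with y-only x (~-sym x~y)
    ...               | inj₁ refl = ⊥-elim (~-irr p~x)
    ...               | inj₂ refl = x , y , record { p~x = p~x ; p~y = p~y ; x-poor = px ; y-poor = py ; x-only = x-only ; y-only = y-only }

    mid≢poor : ∀ {x y} → Place x mid → Place y poor → x ≢ y
    mid≢poor px py refl with place-unique px py
    ... | ()

    -- A three-edge path between vertices of two pendant triangles would have its middle edge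
    -- between the triangles. The only possible such edge is `p ~ p′`, and it would make both
    -- vertices good.
    Bad-unique : ∀ {p p′} → Bad p → Bad p′ → p ≡ p′
    Bad-unique {p} {p′} bad bad′ with p ≟ p′ | pendant bad | pendant bad′
    ... | yes p≡p′ | _ | _ = p≡p′
    ... | no p≢p′ | x , y , P | x′ , y′ , P′ = ⊥-elim (contradict (path x≢x′ x≁x′))
      where
      mid-p  = bad-mid bad
      mid-p′ = bad-mid bad′
      open Pendant P
      open Pendant P′ using () renaming (p~x to p′~x′; p~y to p′~y′; x-poor to x′-poor; y-poor to y′-poor; x-only to x′-only; y-only to y′-only)
      x≁p′ : ¬ x ~ p′
      x≁p′ x~p′ = [ ≢-sym p≢p′ , mid≢poor mid-p′ y-poor ]′ (x-only p′ x~p′)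
      y≁p′ : ¬ y ~ p′
      y≁p′ y~p′ = [ ≢-sym p≢p′ , mid≢poor mid-p′ x-poor ]′ (y-only p′ y~p′)
      p≁y′ : ¬ p ~ y′
      p≁y′ p~y′ = [ p≢p′ , mid≢poor mid-p x′-poor ]′ (y′-only p (~-sym p~y′))
      x≢x′ : x ≢ x′
      x≢x′ refl = x≁p′ (~-sym p′~x′)
      x≁x′ : ¬ x ~ x′
      x≁x′ x~x′ with x-only x′ x~x′
      ... | inj₁ x′≡p = mid≢poor mid-p x′-poor (sym x′≡p)
      ... | inj₂ refl = y≁p′ (~-sym p′~x′)
      contradict : Path _~_ x x′ → ⊥
      contradict π with x-only _ (Path.x~p π) | x′-only _ (~-sym (Path.q~y π)) | Path.p~q π
      ... | inj₁ refl | inj₁ refl | p~p′ = proj₂ bad (good p~p′ mid-p′ refl)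
      ... | inj₁ refl | inj₂ refl | p~y′ = p≁y′ p~y′
      ... | inj₂ refl | inj₁ refl | y~p′ = y≁p′ y~p′
      ... | inj₂ refl | inj₂ refl | y~y′ with y-only _ y~y′
      ...   | inj₁ y′≡p = mid≢poor mid-p y′-poor (sym y′≡p)
      ...   | inj₂ refl = x≁p′ (~-sym p′~y′)

    share-good : ∀ {x k} → Place x k → (Place x mid → Good x) → 3 ≤ share x + 3 * δ v x
    share-good (at-root refl) _ = ≤-trans (≤-reflexive (sym (cong (3 *_) (δ-refl v)))) (m≤n+m _ (share v))
    -- The root lies in a triangle, so `x` is adjacent to the other neighbour of `v` and gets 2 + 1.
    share-good {x} pl@(at-near v~x) _ with Two-at Tv v~x
    ... | z , Tv′@(_ , v~z , _) = ≤-trans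
      (share-≥ x ((v , 2) ∷ (z , 1) ∷ []) ((~⇒≢ v~z ∷ []) ∷ [] ∷ [])
        ((~-sym v~x , weigh pl (at-root refl)) ∷ (triangle Tv′ , weigh pl (at-near v~z)) ∷ []))
      (m≤m+n _ _)
    share-good {x} pl@(at-mid p _ _ v~p p~x) is-good with is-good pl
    ... | y , x~y , w≡1 = ≤-trans
      (share-≥ x ((p , 2) ∷ (y , 1) ∷ []) ((p≢y ∷ []) ∷ [] ∷ [])
        ((~-sym p~x , weigh pl (at-near v~p)) ∷ (x~y , ≤-reflexive (sym (trans (cong (λ k → weight k (kind y)) (kind-≡ pl)) w≡1))) ∷ []))
      (m≤m+n _ _)
      where
      p≢y : p ≢ y
      p≢y refl with trans (sym w≡1) (cong (weight mid) (kind-≡ (at-near v~p)))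
      ... | ()
    share-good {x} (at-far x≢v v≁x none) _ with far-shape (x≢v , v≁x , none)
    ... | inj₁ (px , c , d , e , (x~c , x~d , x~e) , (c≢d , c≢e , d≢e)) = ≤-trans
      (share-≥ x ((c , 1) ∷ (d , 1) ∷ (e , 1) ∷ []) ((c≢d ∷ c≢e ∷ []) ∷ (d≢e ∷ []) ∷ [] ∷ [])
        ((x~c , far-weight far x~c) ∷ (x~d , far-weight far x~d) ∷ (x~e , far-weight far x~e) ∷ []))
      (m≤m+n _ _)
      where far = x≢v , v≁x , none
    ... | inj₂ (px , _) with path (≢-sym x≢v) v≁x
    ...   | π with another (~-sym (Path.q~y π))
    ...     | y , x~y , y≢q = ≤-trans
      (share-≥ x ((Path.q π , 2) ∷ (y , 1) ∷ []) ((≢-sym y≢q ∷ []) ∷ [] ∷ [])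
        ((~-sym (Path.q~y π) , weigh px (mid-on-path far π)) ∷ (x~y , far-weight far x~y) ∷ []))
      (m≤m+n _ _)
      where far = x≢v , v≁x , none

    share-mid : ∀ {x} → Place x mid → 2 ≤ share x
    share-mid {x} pl with mid⁻ pl refl
    ... | _ , _ , p , v~p , p~x =
      share-≥ x ((p , 2) ∷ []) ([] ∷ []) ((~-sym p~x , weigh pl (at-near v~p)) ∷ [])

    -- The root costs 3 and the bad vertex, if there is one, costs 1; |U| ≤ 3 fills up the 7.
    bound-triangles : n * 3 + sum (ind ∘ U) ≤ ends R + 7
    bound-triangles = begin
      n * 3 + sum (ind ∘ U)
        ≤⟨ +-mono-≤ (≤-reflexive (sym (sum-const n 3))) U≤3 ⟩
      sum {n} (λ _ → 3) + 3
        ≤⟨ +-monoˡ-≤ 3 total ⟩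
      (ends R + 4) + 3
        ≡⟨ +-assoc (ends R) 4 3 ⟩
      ends R + 7 ∎
      where
      open ≤-Reasoning
      total : sum {n} (λ _ → 3) ≤ ends R + 4
      total with any? Bad?
      ... | no none = ≤-trans (discharge (λ x → share-good (place x) (is-good x)))
                        (+-monoʳ-≤ (ends R) (≤-trans (≤-reflexive (sum-δ v 3)) (n≤1+n 3)))
        where
        is-good : ∀ x → Place x mid → Good x
        is-good x mid-x with Good? x
        ... | yes g = g
        ... | no ¬g = ⊥-elim (none (x , kind-≡ mid-x , ¬g))
      ... | yes (p₀ , bad₀) = ≤-trans (discharge pointwise)
                                (≤-reflexive (cong (ends R +_) (trans (sum-+δ (λ x → 3 * δ v x) p₀ 1) (cong (_+ 1) (sum-δ v 3)))))
        where
        is-good : ∀ x → p₀ ≢ x → Place x mid → Good x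
        is-good x p₀≢x mid-x with Good? x
        ... | yes g = g
        ... | no ¬g = ⊥-elim (p₀≢x (Bad-unique bad₀ (kind-≡ mid-x , ¬g)))
        pointwise : ∀ x → 3 ≤ share x + (3 * δ v x + 1 * δ p₀ x)
        pointwise x with p₀ ≟ x
        ... | yes refl = +-mono-≤ (share-mid (bad-mid bad₀)) (m≤n+m 1 (3 * δ v x))
        ... | no p₀≢x  = ≤-trans (share-good (place x) (is-good x p₀≢x)) (+-monoʳ-≤ (share x) (m≤m+n _ 0))

bound : ∀ {n} {R : Fin n → Fin n → Bool} {U : Fin n → Bool} → Saturated R U → n * 3 + sum (ind ∘ U) ≤ ends R + 7
bound {n} {R} {U} sat with any? (Structure.Leaf? sat)
... | yes (l , w , Ll) = Leaves.bound-leaf sat Ll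
... | no none = by-degree-two (any? (λ v → any? (λ a → any? (λ b → Two? v a b ×-dec ¬? (a ~? b)))))
                              (any? (λ v → any? (λ a → any? (λ b → Two? v a b))))
  where
  open Saturated sat
  open Structure sat
  open NoLeaves sat (λ x l → none (x , l))
  by-degree-two : Dec (∃ λ v → ∃ λ a → ∃ λ b → Two v a b × ¬ a ~ b) → Dec (∃ λ v → ∃ λ a → ∃ λ b → Two v a b) →
                  n * 3 + sum (ind ∘ U) ≤ ends R + 7
  by-degree-two (yes (_ , _ , _ , T , a≁b)) _ = bound-nonadjacent T a≁b
  by-degree-two (no no-T) (yes (_ , _ , _ , T)) = Triangles.bound-triangles triangle T
    where
    triangle : ∀ {x a b} → Two x a b → a ~ b
    triangle {x} {a} {b} T with a ~? b
    ... | yes a~b = a~b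
    ... | no a≁b  = ⊥-elim (no-T (x , a , b , T , a≁b))
  by-degree-two (no _) (no no-T) = bound-cubic three
    where
    three : ∀ x → Three x
    three x with shape x
    ... | inj₁ (a , b , T) = ⊥-elim (no-T (x , a , b , T))
    ... | inj₂ th = th

-- The red graph of a critical colouring

NoC4 : ∀ {n} → (Fin n → Fin n → Set) → Set
NoC4 _~_ = ∀ {a b x d} → a ≢ x → b ≢ d → a ~ b → b ~ x → x ~ d → d ~ a → ⊥

NoP3 : ∀ {n} → (Fin n → Fin n → Set) → Set
NoP3 _~_ = ∀ {a b x} → b ≢ x → a ~ b → a ~ x → ⊥

Path? : ∀ {n} {_~_ : Fin n → Fin n → Set} → (∀ x y → Dec (x ~ y)) → ∀ x y → Dec (Path _~_ x y)
Path? {_~_ = _~_} _~?_ x y = map′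
  (λ { (p , q , x~p , p~q , q~y , x≢q , p≢y) → record { x~p = x~p ; p~q = p~q ; q~y = q~y ; x≢q = x≢q ; p≢y = p≢y } })
  vertices
  (any? λ p → any? λ q → (x ~? p) ×-dec (p ~? q) ×-dec (q ~? y) ×-dec ¬? (x ≟ q) ×-dec ¬? (p ≟ y))
  where
  vertices : Path _~_ x y → ∃ λ p → ∃ λ q → x ~ p × p ~ q × q ~ y × x ≢ q × p ≢ y
  vertices π = p , q , x~p , p~q , q~y , x≢q , p≢y
    where open Path π

-- Adding a single pair to a relation

pair : ∀ {n} → Fin n → Fin n → Fin n → Fin n → Bool
pair u v i j = (⌊ i ≟ u ⌋ ∧ ⌊ j ≟ v ⌋) ∨ (⌊ i ≟ v ⌋ ∧ ⌊ j ≟ u ⌋)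

SamePair : ∀ {n} → Fin n → Fin n → Fin n → Fin n → Set
SamePair u v i j = (i ≡ u × j ≡ v) ⊎ (i ≡ v × j ≡ u)

pair⁻ : ∀ {n} {u v i j : Fin n} → pair u v i j ≡ true → SamePair u v i j
pair⁻ {u = u} {v} {i} {j} eq with i ≟ u | j ≟ v | i ≟ v | j ≟ u
... | yes i≡u | yes j≡v | _       | _       = inj₁ (i≡u , j≡v)
... | yes _   | no _    | yes i≡v | yes j≡u = inj₂ (i≡v , j≡u)
... | no _    | _       | yes i≡v | yes j≡u = inj₂ (i≡v , j≡u)
pair⁻ () | yes _ | no _ | yes _ | no _
pair⁻ () | yes _ | no _ | no _  | _
pair⁻ () | no _  | _    | yes _ | no _
pair⁻ () | no _  | _    | no _  | _

pair⁺ : ∀ {n} (u v : Fin n) → pair u v u v ≡ true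
pair⁺ u v with u ≟ u | v ≟ v
... | yes _  | yes _  = refl
... | no u≢u | _      = ⊥-elim (u≢u refl)
... | _      | no v≢v = ⊥-elim (v≢v refl)

pair-sym : ∀ {n} (u v i j : Fin n) → pair u v i j ≡ pair u v j i
pair-sym u v i j = trans (∨-comm (⌊ i ≟ u ⌋ ∧ ⌊ j ≟ v ⌋) _)
  (cong₂ _∨_ (∧-comm ⌊ i ≟ v ⌋ ⌊ j ≟ u ⌋) (∧-comm ⌊ i ≟ u ⌋ ⌊ j ≟ v ⌋))

pair-same : ∀ {n} {u v i j : Fin n} → SamePair u v i j → pair u v i j ≡ true
pair-same {u = u} {v} (inj₁ (refl , refl)) = pair⁺ u v
pair-same {u = u} {v} (inj₂ (refl , refl)) = trans (pair-sym u v v u) (pair⁺ u v)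

SamePair-unique : ∀ {n} {u v i j k l : Fin n} → SamePair u v i j → SamePair u v k l → (i ≡ k × j ≡ l) ⊎ (i ≡ l × j ≡ k)
SamePair-unique (inj₁ (refl , refl)) (inj₁ (refl , refl)) = inj₁ (refl , refl)
SamePair-unique (inj₁ (refl , refl)) (inj₂ (refl , refl)) = inj₂ (refl , refl)
SamePair-unique (inj₂ (refl , refl)) (inj₁ (refl , refl)) = inj₂ (refl , refl)
SamePair-unique (inj₂ (refl , refl)) (inj₂ (refl , refl)) = inj₁ (refl , refl)

module _ {n} {_~_ _~′_ : Fin n → Fin n → Set} {u v : Fin n}
         (~-sym : ∀ {i j} → i ~ j → j ~ i) (~′-irr : ∀ {i} → ¬ i ~′ i)
         (old : ∀ {i j} → i ~′ j → i ~ j ⊎ SamePair u v i j) where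

  -- Another edge of the cycle cannot be the same new pair, as two vertices of the cycle would
  -- coincide. So the other three edges are old and form the path.
  C4-through : ∀ {a b x d} → a ≢ x → b ≢ d → a ~′ b → b ~′ x → x ~′ d → d ~′ a → SamePair u v d a → Path _~_ u v
  C4-through {a} {b} {x} {d} a≢x b≢d a~b b~x x~d d~a da with old a~b | old b~x | old x~d
  ... | inj₂ ab | _ | _ = ⊥-elim ([ (λ { (refl , _) → ~′-irr d~a }) , (λ { (_ , b≡d) → b≢d b≡d }) ]′ (SamePair-unique ab da))
  ... | _ | inj₂ bx | _ = ⊥-elim ([ (λ { (b≡d , _) → b≢d b≡d }) , (λ { (refl , _) → ~′-irr a~b }) ]′ (SamePair-unique bx da))
  ... | _ | _ | inj₂ xd = ⊥-elim ([ (λ { (refl , _) → ~′-irr x~d }) , (λ { (x≡a , _) → a≢x (sym x≡a) }) ]′ (SamePair-unique xd da))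
  ... | inj₁ ab | inj₁ bx | inj₁ xd with da
  ...   | inj₁ (refl , refl) = record { x~p = ~-sym xd ; p~q = ~-sym bx ; q~y = ~-sym ab ; x≢q = ≢-sym b≢d ; p≢y = ≢-sym a≢x }
  ...   | inj₂ (refl , refl) = record { x~p = ab ; p~q = bx ; q~y = xd ; x≢q = a≢x ; p≢y = b≢d }

  NoC4-extend : NoC4 _~_ → ¬ Path _~_ u v → NoC4 _~′_
  NoC4-extend noC4 no-path a≢x b≢d a~b b~x x~d d~a with old a~b | old b~x | old x~d | old d~a
  ... | inj₁ ab | inj₁ bx | inj₁ xd | inj₁ da = noC4 a≢x b≢d ab bx xd da
  ... | _ | _ | _ | inj₂ da = no-path (C4-through a≢x b≢d a~b b~x x~d d~a da)
  ... | inj₂ ab | _ | _ | _ = no-path (C4-through b≢d (≢-sym a≢x) b~x x~d d~a a~b ab)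
  ... | _ | inj₂ bx | _ | _ = no-path (C4-through (≢-sym a≢x) (≢-sym b≢d) x~d d~a a~b b~x bx)
  ... | _ | _ | inj₂ xd | _ = no-path (C4-through (≢-sym b≢d) a≢x d~a a~b b~x x~d xd)

module Colours {n} {G : Graph n} (c : Coloring G) where
  red blue : Fin n → Fin n → Bool
  red  i j = adj G i j ∧ col c i j
  blue i j = adj G i j ∧ not (col c i j)

  Red Blue : Fin n → Fin n → Set
  Red  i j = red i j ≡ true
  Blue i j = blue i j ≡ true

  red⁺ : ∀ {i j} → redEdge c i j → Red i j
  red⁺ (e , k) = cong₂ _∧_ e k

  red⁻ : ∀ {i j} → Red i j → redEdge c i j
  red⁻ {i} {j} r with adj G i j | col c i j
  ... | true | true = refl , refl

  blue⁺ : ∀ {i j} → blueEdge c i j → Blue i j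
  blue⁺ (e , k) = cong₂ (λ p q → p ∧ not q) e k

  blue⁻ : ∀ {i j} → Blue i j → blueEdge c i j
  blue⁻ {i} {j} b with adj G i j | col c i j
  ... | true | false = refl , refl

  Red-or-blue : ∀ {i j} → adj G i j ≡ true → Red i j ⊎ Blue i j
  Red-or-blue {i} {j} e with col c i j
  ... | true  = inj₁ (cong (_∧ true) e)
  ... | false = inj₂ (cong (_∧ true) e)

  adj-≢ : ∀ {i j} → adj G i j ≡ true → i ≢ j
  adj-≢ {i} e refl with trans (sym e) (adj-irrefl G i)
  ... | ()

  Red-sym : ∀ {i j} → Red i j → Red j i
  Red-sym {i} {j} r = trans (cong₂ _∧_ (adj-sym G j i) (colSym c j i)) r

  Blue-sym : ∀ {i j} → Blue i j → Blue j i
  Blue-sym {i} {j} b = trans (cong₂ (λ p q → p ∧ not q) (adj-sym G j i) (colSym c j i)) b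

  critical⁺ : NoC4 Red → NoP3 Blue → Critical c
  critical⁺ noC4 noP3 =
      (λ { (a , b , x , d , _ , a≢x , _ , _ , b≢d , _ , ab , bx , xd , da) → noC4 a≢x b≢d (red⁺ ab) (red⁺ bx) (red⁺ xd) (red⁺ da) })
    , (λ { (a , b , x , _ , _ , b≢x , ab , ax) → noP3 b≢x (blue⁺ ab) (blue⁺ ax) })

  critical⁻ : Critical c → NoC4 Red × NoP3 Blue
  critical⁻ (no-red , no-blue) =
      (λ a≢x b≢d ab bx xd da → no-red (_ , _ , _ , _ , ≢ ab , a≢x , ≢-sym (≢ da) , ≢ bx , b≢d , ≢ xd , red⁻ ab , red⁻ bx , red⁻ xd , red⁻ da))
    , (λ b≢x ab ax → no-blue (_ , _ , _ , adj-≢ (proj₁ (blue⁻ ab)) , adj-≢ (proj₁ (blue⁻ ax)) , b≢x , blue⁻ ab , blue⁻ ax))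
    where
    ≢ : ∀ {i j} → Red i j → i ≢ j
    ≢ r = adj-≢ (proj₁ (red⁻ r))

∨-true : ∀ p q → p ∨ q ≡ true → p ≡ true ⊎ q ≡ true
∨-true true  _ _ = inj₁ refl
∨-true false _ q = inj₂ q

∨-false : ∀ p q → p ∨ q ≡ false → p ≡ false × q ≡ false
∨-false false false _ = refl , refl

module Maximal {n} (G : Graph n) (co : CoCritical G) where

  not-critical : ∀ {u v} (u≢v : u ≢ v) → adj G u v ≡ false → (k : Coloring (addEdge G u v u≢v)) →
                 NoC4 (Colours.Red k) → NoP3 (Colours.Blue k) → ⊥
  not-critical u≢v e k noC4 noP3 = proj₂ (proj₂ co) _ _ u≢v e (k , Colours.critical⁺ k noC4 noP3)

  module _ (c : Coloring G) (crit : Critical c) where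
    open Colours c
    noC4 = proj₁ (critical⁻ crit)
    noP3 = proj₂ (critical⁻ crit)

    Red? : ∀ i j → Dec (Red i j)
    Red? i j = red i j Bool.≟ true

    free : Fin n → Bool
    free i = not ⌊ any? (λ j → blue i j Bool.≟ true) ⌋

    free⁻ : ∀ {i} → free i ≡ true → ∀ j → ¬ Blue i j
    free⁻ {i} f j b with any? (λ j → blue i j Bool.≟ true)
    ... | no none = none (j , b)

    col-new : (u v i j : Fin n) → Bool
    col-new u v i j = col c i j ∨ pair u v i j

    col-new-sym : ∀ u v i j → col-new u v i j ≡ col-new u v j i
    col-new-sym u v i j = cong₂ _∨_ (colSym c i j) (pair-sym u v i j)

    -- Colouring the new edge red leaves the blue edges as they were, so it must close a red C4.
    nonedge-path : ∀ {u v} → u ≢ v → adj G u v ≡ false → Path Red u v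
    nonedge-path {u} {v} u≢v e with Path? Red? u v
    ... | yes π = π
    ... | no no-path = ⊥-elim (not-critical u≢v e k
                         (NoC4-extend Red-sym (λ r → Colours.adj-≢ k (proj₁ (Colours.red⁻ k r)) refl) old noC4 no-path)
                         (λ b≢x ab ax → noP3 b≢x (old-blue ab) (old-blue ax)))
      where
      k : Coloring (addEdge G u v u≢v)
      k = record { col = col-new u v ; colSym = col-new-sym u v }
      old : ∀ {i j} → Colours.Red k i j → Red i j ⊎ SamePair u v i j
      old {i} {j} r with Colours.red⁻ k r
      ... | e′ , k′ with ∨-true (adj G i j) _ e′ | ∨-true (col c i j) _ k′
      ...   | inj₂ p | _      = inj₂ (pair⁻ p)
      ...   | inj₁ _ | inj₂ p = inj₂ (pair⁻ p)
      ...   | inj₁ a | inj₁ b = inj₁ (red⁺ (a , b))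
      old-blue : ∀ {i j} → Colours.Blue k i j → Blue i j
      old-blue {i} {j} b with Colours.blue⁻ k b
      ... | e′ , k′ with ∨-false (col c i j) _ k′
      ...   | c≡f , p≡f with ∨-true (adj G i j) _ e′
      ...     | inj₁ a = blue⁺ (a , c≡f)
      ...     | inj₂ p with trans (sym p≡f) p
      ...       | ()

    module Recolour {u v} (uv : Blue u v) (no-path : ¬ Path Red u v) where

      c′ : Coloring G
      c′ = record { col = col-new u v ; colSym = col-new-sym u v }

      crit′ : Critical c′
      crit′ = Colours.critical⁺ c′
        (NoC4-extend Red-sym (λ r → adj-≢ (proj₁ (Colours.red⁻ c′ r)) refl) old noC4 no-path)
        (λ b≢x ab ax → noP3 b≢x (old-blue ab) (old-blue ax))
        where
        old : ∀ {i j} → Colours.Red c′ i j → Red i j ⊎ SamePair u v i j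
        old {i} {j} r with Colours.red⁻ c′ r
        ... | e , k with ∨-true (col c i j) _ k
        ...   | inj₁ b = inj₁ (red⁺ (e , b))
        ...   | inj₂ p = inj₂ (pair⁻ p)
        old-blue : ∀ {i j} → Colours.Blue c′ i j → Blue i j
        old-blue {i} {j} b with Colours.blue⁻ c′ b
        ... | e , k = blue⁺ (e , proj₁ (∨-false (col c i j) _ k))

      -- Only the ordered pair (u, v) is charged, although (v, u) disappears too: a strict decrease
      -- is enough for the recursion in `ends-bound`.
      fewer-blue : ends (Colours.blue c′) < ends blue
      fewer-blue = begin
        suc (ends blue′)
          ≡⟨ +-comm 1 (ends blue′) ⟩
        ends blue′ + 1
          ≡⟨ sum-+δ (λ i → sum (ind ∘ blue′ i)) u 1 ⟨
        sum (λ i → sum (ind ∘ blue′ i) + 1 * δ u i)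
          ≡⟨ sum-cong-≗ (λ i → sum-+δ (ind ∘ blue′ i) v (1 * δ u i)) ⟨
        sum (λ i → sum (λ j → ind (blue′ i j) + 1 * δ u i * δ v j))
          ≤⟨ sum-mono (λ i → sum-mono (λ j → pointwise i j)) ⟩
        ends blue ∎
        where
        open ≤-Reasoning
        blue′ = Colours.blue c′
        less : ∀ i j → ind (blue′ i j) ≤ ind (blue i j)
        less i j with adj G i j | col c i j | pair u v i j
        ... | false | _     | _     = z≤n
        ... | true  | true  | _     = z≤n
        ... | true  | false | true  = z≤n
        ... | true  | false | false = ≤-refl
        pointwise : ∀ i j → ind (blue′ i j) + 1 * δ u i * δ v j ≤ ind (blue i j)
        pointwise i j with u ≟ i | v ≟ j
        ... | yes refl | yes refl = ≤-reflexive (trans (cong (λ b → ind b + 1) blue′-uv) (sym (cong ind uv)))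
          where
          blue′-uv : blue′ u v ≡ false
          blue′-uv = trans (cong (λ b → adj G u v ∧ not (col c u v ∨ b)) (pair⁺ u v))
                           (trans (cong (λ b → adj G u v ∧ not b) (∨-zeroʳ (col c u v))) (∧-zeroʳ (adj G u v)))
        ... | yes _ | no _  = ≤-trans (≤-reflexive (+-identityʳ _)) (less i j)
        ... | no _  | _     = ≤-trans (≤-reflexive (+-identityʳ _)) (less i j)

    module _ {s t} (fs : free s ≡ true) (ft : free t ≡ true) where

      NoP3-extend : ∀ {Blue′ : Fin n → Fin n → Set} → (∀ {i j} → Blue′ i j → Blue i j ⊎ SamePair s t i j) → NoP3 Blue′
      NoP3-extend old b≢x ab ax with old ab | old ax
      ... | inj₁ ab′ | inj₁ ax′ = noP3 b≢x ab′ ax′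
      ... | inj₁ ab′ | inj₂ (inj₁ (refl , refl)) = free⁻ fs _ ab′
      ... | inj₁ ab′ | inj₂ (inj₂ (refl , refl)) = free⁻ ft _ ab′
      ... | inj₂ (inj₁ (refl , refl)) | inj₁ ax′ = free⁻ fs _ ax′
      ... | inj₂ (inj₂ (refl , refl)) | inj₁ ax′ = free⁻ ft _ ax′
      ... | inj₂ ab′ | inj₂ ax′ with SamePair-unique ab′ ax′
      ...   | inj₁ (_ , b≡x) = b≢x b≡x
      ...   | inj₂ (a≡x , b≡a) = b≢x (trans b≡a a≡x)

      -- If `st` were not an edge, it could be added in blue, because neither end has a blue edge.
      -- As an edge it cannot be blue.
      free-clique : s ≢ t → Red s t
      free-clique s≢t = by-adj (adj G s t) refl
        where
        k : adj G s t ≡ false → Coloring (addEdge G s t s≢t)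
        k e = record { col = λ i j → col c i j ∧ not (pair s t i j)
                     ; colSym = λ i j → cong₂ (λ p q → p ∧ not q) (colSym c i j) (pair-sym s t i j) }
        module _ (e : adj G s t ≡ false) where
          old : ∀ {i j} → Colours.Red (k e) i j → Red i j
          old {i} {j} r with pair s t i j | adj G i j | col c i j
          old r  | false | true  | true  = refl
          old () | true  | true  | true
          old () | true  | true  | false
          old () | true  | false | true
          old () | true  | false | false
          old-blue : ∀ {i j} → Colours.Blue (k e) i j → Blue i j ⊎ SamePair s t i j
          old-blue {i} {j} b with pair s t i j in p | adj G i j | col c i j
          ... | true  | _    | _     = inj₂ (pair⁻ p)
          ... | false | true | false = inj₁ refl
        by-adj : ∀ a → adj G s t ≡ a → Red s t
        by-adj true e with Red-or-blue e
        ... | inj₁ r = r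
        ... | inj₂ b = ⊥-elim (free⁻ fs t b)
        by-adj false e = ⊥-elim (not-critical s≢t e (k e)
          (λ a≢x b≢d ab bx xd da → noC4 a≢x b≢d (old e ab) (old e bx) (old e xd) (old e da))
          (NoP3-extend (old-blue e)))

      -- As `s` has no blue edge, `xs` is not an edge of `G`. Add it in red and recolour `st` blue:
      -- no blue path arises, so some red C4 does, and without `xs` it is a path among the red edges
      -- other than `st`.
      avoiding : s ≢ t → ∀ {x} → x ≢ s → ¬ Red x s → Σ (Path Red x s) λ π → Path.q π ≢ t
      avoiding s≢t {x} x≢s x≁s with Path? Kept? x s
        where
        Kept? : ∀ i j → Dec (Red i j × ¬ SamePair s t i j)
        Kept? i j = Red? i j ×-dec ¬? (((i ≟ s) ×-dec (j ≟ t)) ⊎-dec ((i ≟ t) ×-dec (j ≟ s)))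
      ... | yes π = record { x~p = proj₁ x~p ; p~q = proj₁ p~q ; q~y = proj₁ q~y ; x≢q = x≢q ; p≢y = p≢y }
                  , (λ { refl → proj₂ q~y (inj₂ (refl , refl)) })
        where open Path π
      ... | no no-path = ⊥-elim (not-critical x≢s nonedge k
          (NoC4-extend kept-sym (λ r → Colours.adj-≢ k (proj₁ (Colours.red⁻ k r)) refl) old
            (λ a≢x b≢d ab bx xd da → noC4 a≢x b≢d (proj₁ ab) (proj₁ bx) (proj₁ xd) (proj₁ da)) no-path)
          (NoP3-extend old-blue))
        where
        nonedge : adj G x s ≡ false
        nonedge = ¬-not not-edge
          where
          not-edge : adj G x s ≢ true
          not-edge e with Red-or-blue e
          ... | inj₁ r = x≁s r
          ... | inj₂ b = free⁻ fs x (Blue-sym b)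
        kept-sym : ∀ {i j} → Red i j × ¬ SamePair s t i j → Red j i × ¬ SamePair s t j i
        kept-sym (r , other) = Red-sym r , λ { (inj₁ (p , q)) → other (inj₂ (q , p)) ; (inj₂ (p , q)) → other (inj₁ (q , p)) }
        k : Coloring (addEdge G x s x≢s)
        k = record { col = λ i j → (col c i j ∧ not (pair s t i j)) ∨ pair x s i j
                   ; colSym = λ i j → cong₂ _∨_ (cong₂ (λ p q → p ∧ not q) (colSym c i j) (pair-sym s t i j)) (pair-sym x s i j) }
        old : ∀ {i j} → Colours.Red k i j → (Red i j × ¬ SamePair s t i j) ⊎ SamePair x s i j
        old {i} {j} r with pair x s i j in new | pair s t i j in gone | adj G i j | col c i j
        ... | true  | _     | _    | _    = inj₂ (pair⁻ new)
        ... | false | false | true | true = inj₁ (refl , λ st → not-gone (trans (sym (pair-same st)) gone))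
          where
          not-gone : ¬ true ≡ false
          not-gone ()
        old-blue : ∀ {i j} → Colours.Blue k i j → Blue i j ⊎ SamePair s t i j
        old-blue {i} {j} b with pair s t i j in p | pair x s i j | adj G i j | col c i j
        old-blue b  | true  | _     | _     | _     = inj₂ (pair⁻ p)
        old-blue b  | false | false | true  | false = inj₁ refl
        old-blue () | false | true  | true  | true
        old-blue () | false | true  | true  | false
        old-blue () | false | true  | false | true
        old-blue () | false | true  | false | false

-- Assembling the lower bound

third-element : ∀ {n} → 5 ≤ n → ∀ (x y : Fin n) → ∃ λ z → z ≢ x × z ≢ y
third-element (s≤s (s≤s (s≤s _))) zero          zero          = suc zero       , (λ ()) , (λ ())
third-element (s≤s (s≤s (s≤s _))) zero          (suc zero)    = suc (suc zero) , (λ ()) , (λ ())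
third-element (s≤s (s≤s (s≤s _))) zero          (suc (suc _)) = suc zero       , (λ ()) , (λ ())
third-element (s≤s (s≤s (s≤s _))) (suc zero)    zero          = suc (suc zero) , (λ ()) , (λ ())
third-element (s≤s (s≤s (s≤s _))) (suc (suc _)) zero          = suc zero       , (λ ()) , (λ ())
third-element (s≤s (s≤s (s≤s _))) (suc _)       (suc _)       = zero           , (λ ()) , (λ ())

module _ {n} (5≤n : 5 ≤ n) (G : Graph n) (co : CoCritical G) where
  open Maximal G co
  open Colours

  saturated : ∀ c (crit : Critical c) → (∀ u v → Blue c u v → Path (Red c) u v) → Saturated (red c) (free c crit)
  saturated c crit blue-path = record
    { third    = third-element 5≤n
    ; ~-sym    = Red-sym c
    ; ~-irr    = λ r → adj-≢ c (proj₁ (red⁻ c r)) refl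
    ; noC4     = noC4 c crit
    ; path     = path
    ; U-clique = free-clique c crit
    ; avoid    = λ fs ft s≢t → avoiding c crit fs ft s≢t
    }
    where
    path : ∀ {x y} → x ≢ y → ¬ Red c x y → Path (Red c) x y
    path {x} {y} x≢y x≁y = by-adj (adj G x y) refl
      where
      by-adj : ∀ a → adj G x y ≡ a → Path (Red c) x y
      by-adj false e = nonedge-path c crit x≢y e
      by-adj true  e with Red-or-blue c e
      ... | inj₁ r = ⊥-elim (x≁y r)
      ... | inj₂ b = blue-path x y b

  matched-or-free : ∀ c (crit : Critical c) → n ≤ ends (blue c) + sum (ind ∘ free c crit)
  matched-or-free c crit = begin
    n
      ≡⟨ *-identityʳ n ⟨
    n * 1
      ≡⟨ sum-const n 1 ⟨
    sum {n} (λ _ → 1)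
      ≤⟨ sum-mono pointwise ⟩
    sum (λ i → sum (ind ∘ blue c i) + ind (free c crit i))
      ≡⟨ ∑-distrib-+ (λ i → sum (ind ∘ blue c i)) (ind ∘ free c crit) ⟩
    ends (blue c) + sum (ind ∘ free c crit) ∎
    where
    open ≤-Reasoning
    pointwise : ∀ i → 1 ≤ sum (ind ∘ blue c i) + ind (free c crit i)
    pointwise i with any? (λ j → blue c i j Bool.≟ true)
    ... | no _ = m≤n+m 1 _
    ... | yes (j , b) = ≤-trans (≤-trans (≤-reflexive (sym (trans (+-identityʳ _) (cong ind b))))
                                         (sum-distinct (ind ∘ blue c i) (j ∷ []) ([] ∷ [])))
                                (m≤m+n _ 0)

  ends-split : ∀ (c : Coloring G) → ends (adj G) ≡ ends (red c) + ends (blue c)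
  ends-split c = trans
    (sum-cong-≗ (λ i → trans (sum-cong-≗ (pointwise i)) (∑-distrib-+ (ind ∘ red c i) (ind ∘ blue c i))))
    (∑-distrib-+ (λ i → sum (ind ∘ red c i)) (λ i → sum (ind ∘ blue c i)))
    where
    pointwise : ∀ i j → ind (adj G i j) ≡ ind (red c i j) + ind (blue c i j)
    pointwise i j with adj G i j | col c i j
    ... | false | _     = refl
    ... | true  | true  = refl
    ... | true  | false = refl

  -- `m` is fuel: each recolouring of a blue edge lowers the number of blue ends. Once every blue
  -- edge has a red path, |U| is added to both sides and cancels between `bound` and
  -- `matched-or-free`.
  ends-bound : ∀ m c → Critical c → ends (blue c) ≤ m → n * 4 ≤ ends (adj G) + 7
  ends-bound m c crit blue≤m with any? (λ u → any? (λ v → (blue c u v Bool.≟ true) ×-dec ¬? (Path? (Red? c crit) u v)))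
  ends-bound zero c crit blue≤m | yes (u , v , uv , no-path)
    with ≤-trans (Recolour.fewer-blue c crit uv no-path) blue≤m
  ... | ()
  ends-bound (suc m) c crit blue≤m | yes (u , v , uv , no-path) =
    ends-bound m c′ crit′ (≤-pred (≤-trans fewer-blue blue≤m))
    where open Recolour c crit uv no-path
  ends-bound m c crit blue≤m | no none = +-cancelʳ-≤ free-count _ _ (begin
    n * 4 + free-count
      ≡⟨ cong (_+ free-count) (trans (*-suc n 3) (+-comm n (n * 3))) ⟩
    n * 3 + n + free-count
      ≡⟨ solve 3 (λ a b f → a :+ b :+ f := a :+ f :+ b) refl (n * 3) n free-count ⟩
    n * 3 + free-count + n
      ≤⟨ +-mono-≤ (bound (saturated c crit blue-path)) (matched-or-free c crit) ⟩
    ends (red c) + 7 + (ends (blue c) + free-count)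
      ≡⟨ solve 3 (λ r b f → r :+ con 7 :+ (b :+ f) := r :+ b :+ con 7 :+ f) refl (ends (red c)) (ends (blue c)) free-count ⟩
    ends (red c) + ends (blue c) + 7 + free-count
      ≡⟨ cong (λ e → e + 7 + free-count) (ends-split c) ⟨
    ends (adj G) + 7 + free-count ∎)
    where
    open ≤-Reasoning
    open +-*-Solver
    free-count = sum (ind ∘ free c crit)
    blue-path : ∀ u v → Blue c u v → Path (Red c) u v
    blue-path u v uv with Path? (Red? c crit) u v
    ... | yes π = π
    ... | no no-path = ⊥-elim (none (u , v , uv , no-path))

  edge-bound : 2 * n ∸ 3 ≤ edgeCount G
  edge-bound = m≤n+o⇒m∸n≤o (2 * n) 3 (≮⇒≥ too-few)
    where
    open ≤-Reasoning
    open +-*-Solver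
    e = edgeCount G
    c = proj₁ (proj₁ (proj₂ co))
    crit = proj₂ (proj₁ (proj₂ co))
    too-few : ¬ 3 + e < 2 * n
    too-few e+3<2n = 1+n≰n (begin
      suc (e + e + 7)
        ≡⟨ solve 1 (λ e → con 1 :+ (e :+ e :+ con 7) := (con 1 :+ (con 3 :+ e)) :* con 2) refl e ⟩
      suc (3 + e) * 2
        ≤⟨ *-monoˡ-≤ 2 e+3<2n ⟩
      2 * n * 2
        ≡⟨ solve 1 (λ n → con 2 :* n :* con 2 := n :* con 4) refl n ⟩
      n * 4
        ≤⟨ ends-bound _ c crit ≤-refl ⟩
      ends (adj G) + 7
        ≡⟨ cong (_+ 7) (handshake G) ⟩
      e + e + 7 ∎)

-- Configurations without critical colouring

module Forced {n} {G : Graph n} (k : Coloring G) (crit : Critical k) where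
  open Colours k

  Edge : Fin n → Fin n → Set
  Edge i j = adj G i j ≡ true

  Edge-sym : ∀ {i j} → Edge i j → Edge j i
  Edge-sym {i} {j} e = trans (adj-sym G j i) e

  other-red : ∀ {x y z} → Blue x y → Edge x z → y ≢ z → Red x z
  other-red xy xz y≢z with Red-or-blue xz
  ... | inj₁ r = r
  ... | inj₂ b = ⊥-elim (proj₂ (critical⁻ crit) y≢z xy b)

  two-red : ∀ {h x y z} → h ≢ x → y ≢ z → Red h y → Red h z → Red x y → Red x z → ⊥
  two-red h≢x y≢z hy hz xy xz = proj₁ (critical⁻ crit) h≢x y≢z hy (Red-sym xy) xz (Red-sym hz)

  -- If `hx` were blue, all other edges at `h` and `x` would be red, among them the C4 h, y, x, z.
  hub-red : ∀ {h x y z} → y ≢ z → Edge h x → Edge h y → Edge h z → Edge x y → Edge x z → Red h x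
  hub-red y≢z hx hy hz xy xz with Red-or-blue hx
  ... | inj₁ r = r
  ... | inj₂ b = ⊥-elim (two-red (adj-≢ hx) y≢z
                   (other-red b hy (adj-≢ xy)) (other-red b hz (adj-≢ xz))
                   (other-red (Blue-sym b) xy (adj-≢ hy)) (other-red (Blue-sym b) xz (adj-≢ hz)))

  -- At most one of the three edges at `x` is blue; the other two close a red C4 with `h`.
  no-three : ∀ {h x y z w} → h ≢ x → y ≢ z → y ≢ w → z ≢ w →
             Red h y → Red h z → Red h w → Edge x y → Edge x z → Edge x w → ⊥
  no-three h≢x y≢z y≢w z≢w hy hz hw xy xz xw with Red-or-blue xy
  ... | inj₂ b = two-red h≢x z≢w hz hw (other-red b xz y≢z) (other-red b xw y≢w)
  ... | inj₁ r with Red-or-blue xz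
  ...   | inj₁ r′ = two-red h≢x y≢z hy hz r r′
  ...   | inj₂ b  = two-red h≢x y≢w hy hw r (other-red b xw z≢w)

  -- By `hub-red` the edges at `h` are red. The triangle on the other vertices has two red edges,
  -- and these form a C4 with `h`.
  no-K4 : ∀ {h x y z} → Edge h x → Edge h y → Edge h z → Edge x y → Edge x z → Edge y z → ⊥
  no-K4 {h} {x} {y} {z} hx hy hz xy xz yz = by-colour (Red-or-blue xy) (Red-or-blue xz)
    where
    hx′ : Red h x
    hx′ = hub-red (adj-≢ yz) hx hy hz xy xz
    hy′ : Red h y
    hy′ = hub-red (adj-≢ xz) hy hx hz (Edge-sym xy) yz
    hz′ : Red h z
    hz′ = hub-red (adj-≢ xy) hz hx hy (Edge-sym xz) (Edge-sym yz)
    by-colour : Red x y ⊎ Blue x y → Red x z ⊎ Blue x z → ⊥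
    by-colour (inj₂ b) _         = two-red (adj-≢ hz) (adj-≢ xy) hx′ hy′
                             (Red-sym (other-red b xz (adj-≢ yz))) (Red-sym (other-red (Blue-sym b) yz (adj-≢ xz)))
    by-colour (inj₁ r) (inj₁ r′) = two-red (adj-≢ hx) (adj-≢ yz) hy′ hz′ r r′
    by-colour (inj₁ r) (inj₂ b)  = two-red (adj-≢ hy) (adj-≢ xz) hx′ hz′
                             (Red-sym r) (Red-sym (other-red (Blue-sym b) (Edge-sym yz) (adj-≢ xy)))

  -- All spokes are red, so `az` and `bz` cannot both be red. But they are, if `ab` is blue; and if
  -- `ab` is red, then `da` and `bx` are blue, since two consecutive red rim edges form a C4 with
  -- the hub, and again both are red.
  no-wheel : ∀ {h a b x d z} → Edge h a → Edge h b → Edge h x → Edge h d →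
             Edge a b → Edge b x → Edge x d → Edge d a → a ≢ x → b ≢ d →
             Edge a z → Edge b z → z ≢ h → z ≢ x → z ≢ d → ⊥
  no-wheel ha hb hx hd ab bx xd da a≢x b≢d az bz z≢h z≢x z≢d = meet (reds (Red-or-blue ab))
    where
    Ha : Red _ _
    Ha = hub-red b≢d ha hb hd ab (Edge-sym da)
    Hb : Red _ _
    Hb = hub-red a≢x hb ha hx (Edge-sym ab) bx
    Hx : Red _ _
    Hx = hub-red b≢d hx hb hd (Edge-sym bx) xd
    Hd : Red _ _
    Hd = hub-red a≢x hd ha hx da (Edge-sym xd)
    reds : Red _ _ ⊎ Blue _ _ → Red _ _ × Red _ _
    reds (inj₂ b) = other-red b az (adj-≢ bz) , other-red (Blue-sym b) bz (adj-≢ az)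
    reds (inj₁ r) with Red-or-blue da | Red-or-blue bx
    ... | inj₁ r′ | _       = ⊥-elim (two-red (adj-≢ ha) b≢d Hb Hd r (Red-sym r′))
    ... | _       | inj₁ r′ = ⊥-elim (two-red (adj-≢ hb) a≢x Ha Hx (Red-sym r) r′)
    ... | inj₂ b  | inj₂ b′ = other-red (Blue-sym b) az (≢-sym z≢d) , other-red b′ bz (≢-sym z≢x)
    meet : Red _ _ × Red _ _ → ⊥
    meet (az , bz) = two-red (≢-sym z≢h) (adj-≢ ab) Ha Hb (Red-sym az) (Red-sym bz)

-- Disjoint unions of paths and even cycles

module _ {A : Set} (a : A → A → Bool) where

  HasTwo Deep : A → Set
  HasTwo x = ∃ λ p → ∃ λ q → p ≢ q × a x p ≡ true × a x q ≡ true
  Deep x = ∃ λ p → ∃ λ q → p ≢ q × (a x p ≡ true × HasTwo p) × (a x q ≡ true × HasTwo q)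

  Common : A → A → Set
  Common x y = ∃ λ p → a x p ≡ true × a y p ≡ true

  -- `proper` allows one edge of each colour at a vertex. `extension` gives the reason why a new rim
  -- edge is fatal: a K4 with the hub, or an end whose old neighbours have red spokes by `hub-red`.
  record Rim (c : A → A → Bool) : Set where
    field
      symmetric   : ∀ x y → a x y ≡ a y x
      irreflexive : ∀ x → a x x ≡ false
      inhabited   : ∀ x → ∃ λ y → a x y ≡ true
      extension   : ∀ x y → x ≢ y → a x y ≡ false → Common x y ⊎ Deep x ⊎ Deep y
      c-symmetric : ∀ x y → c x y ≡ c y x
      proper      : ∀ x y z → a x y ≡ true → a x z ≡ true → c x y ≡ c x z → y ≡ z

module _ {n} (a : Fin n → Fin n → Bool) where

  HasTwo? : ∀ x → Dec (HasTwo a x)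
  HasTwo? x = any? λ p → any? λ q → ¬? (p ≟ q) ×-dec (a x p Bool.≟ true) ×-dec (a x q Bool.≟ true)

  Deep? : ∀ x → Dec (Deep a x)
  Deep? x = any? λ p → any? λ q → ¬? (p ≟ q) ×-dec ((a x p Bool.≟ true) ×-dec HasTwo? p) ×-dec ((a x q Bool.≟ true) ×-dec HasTwo? q)

  Rim? : ∀ c → Dec (Rim a c)
  Rim? c = map′
    (λ { (s , i , h , e , t , p) → record { symmetric = s ; irreflexive = i ; inhabited = h ; extension = e ; c-symmetric = t ; proper = p } })
    (λ r → Rim.symmetric r , Rim.irreflexive r , Rim.inhabited r , Rim.extension r , Rim.c-symmetric r , Rim.proper r)
    ((all? λ x → all? λ y → a x y Bool.≟ a y x) ×-dec
     (all? λ x → a x x Bool.≟ false) ×-dec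
     (all? λ x → any? λ y → a x y Bool.≟ true) ×-dec
     (all? λ x → all? λ y → ¬? (x ≟ y) →-dec ((a x y Bool.≟ false) →-dec
       (any? (λ p → (a x p Bool.≟ true) ×-dec (a y p Bool.≟ true)) ⊎-dec (Deep? x ⊎-dec Deep? y)))) ×-dec
     (all? λ x → all? λ y → c x y Bool.≟ c y x) ×-dec
     (all? λ x → all? λ y → all? λ z → (a x y Bool.≟ true) →-dec ((a x z Bool.≟ true) →-dec ((c x y Bool.≟ c x z) →-dec (y ≟ z)))))

-- The graph with the edges x — ρ x (red) and x — β x (blue), where a fixed point of ρ or β stands for no edge.
module _ {n} (ρ β : Vec (Fin n) n) where

  links colours : Fin n → Fin n → Bool
  links   x y = not ⌊ x ≟ y ⌋ ∧ (⌊ lookup ρ x ≟ y ⌋ ∨ ⌊ lookup β x ≟ y ⌋)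
  colours x y = ⌊ lookup ρ x ≟ y ⌋

K2-ρ K2-β : Vec (Fin 2) 2
K2-ρ = 1F ∷ 0F ∷ []
K2-β = 0F ∷ 1F ∷ []

P3-ρ P3-β : Vec (Fin 3) 3
P3-ρ = 1F ∷ 0F ∷ 2F ∷ []
P3-β = 0F ∷ 2F ∷ 1F ∷ []

C4-ρ C4-β : Vec (Fin 4) 4
C4-ρ = 1F ∷ 0F ∷ 3F ∷ 2F ∷ []
C4-β = 3F ∷ 2F ∷ 1F ∷ 0F ∷ []

C6-ρ C6-β : Vec (Fin 6) 6
C6-ρ = 1F ∷ 0F ∷ 3F ∷ 2F ∷ 5F ∷ 4F ∷ []
C6-β = 5F ∷ 2F ∷ 1F ∷ 4F ∷ 3F ∷ 0F ∷ []

K2-rim : Rim (links K2-ρ K2-β) (colours K2-ρ K2-β)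
K2-rim = from-yes (Rim? (links K2-ρ K2-β) (colours K2-ρ K2-β))

P3-rim : Rim (links P3-ρ P3-β) (colours P3-ρ P3-β)
P3-rim = from-yes (Rim? (links P3-ρ P3-β) (colours P3-ρ P3-β))

C4-rim : Rim (links C4-ρ C4-β) (colours C4-ρ C4-β)
C4-rim = from-yes (Rim? (links C4-ρ C4-β) (colours C4-ρ C4-β))

C6-rim : Rim (links C6-ρ C6-β) (colours C6-ρ C6-β)
C6-rim = from-yes (Rim? (links C6-ρ C6-β) (colours C6-ρ C6-β))

-- Joining rims

module _ {A B : Set} where

  infixr 1 _⊎ᵇ_
  _⊎ᵇ_ : (A → A → Bool) → (B → B → Bool) → A ⊎ B → A ⊎ B → Bool
  (a ⊎ᵇ b) (inj₁ x) (inj₁ y) = a x y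
  (a ⊎ᵇ b) (inj₂ x) (inj₂ y) = b x y
  (a ⊎ᵇ b) _        _        = false

  module _ {a c : A → A → Bool} {b d : B → B → Bool} where

    HasTwo-inj₁ : ∀ {x} → HasTwo a x → HasTwo (a ⊎ᵇ b) (inj₁ x)
    HasTwo-inj₁ (p , q , p≢q , xp , xq) = inj₁ p , inj₁ q , (λ { refl → p≢q refl }) , xp , xq

    HasTwo-inj₂ : ∀ {x} → HasTwo b x → HasTwo (a ⊎ᵇ b) (inj₂ x)
    HasTwo-inj₂ (p , q , p≢q , xp , xq) = inj₂ p , inj₂ q , (λ { refl → p≢q refl }) , xp , xq

    Deep-inj₁ : ∀ {x} → Deep a x → Deep (a ⊎ᵇ b) (inj₁ x)
    Deep-inj₁ (p , q , p≢q , (xp , p₂) , (xq , q₂)) =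
      inj₁ p , inj₁ q , (λ { refl → p≢q refl }) , (xp , HasTwo-inj₁ p₂) , (xq , HasTwo-inj₁ q₂)

    Deep-inj₂ : ∀ {x} → Deep b x → Deep (a ⊎ᵇ b) (inj₂ x)
    Deep-inj₂ (p , q , p≢q , (xp , p₂) , (xq , q₂)) =
      inj₂ p , inj₂ q , (λ { refl → p≢q refl }) , (xp , HasTwo-inj₂ p₂) , (xq , HasTwo-inj₂ q₂)

    -- A pair between the two parts has an end in the first, which is deep.
    ⊎-rim : (∀ x → Deep a x) → Rim a c → Rim b d → Rim (a ⊎ᵇ b) (c ⊎ᵇ d)
    ⊎-rim deep ra rb = record
      { symmetric = symmetric ; irreflexive = irreflexive ; inhabited = inhabited
      ; extension = extension ; c-symmetric = c-symmetric ; proper = proper }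
      where
      module ra = Rim ra
      module rb = Rim rb
      symmetric : ∀ x y → (a ⊎ᵇ b) x y ≡ (a ⊎ᵇ b) y x
      symmetric (inj₁ x) (inj₁ y) = ra.symmetric x y
      symmetric (inj₂ x) (inj₂ y) = rb.symmetric x y
      symmetric (inj₁ _) (inj₂ _) = refl
      symmetric (inj₂ _) (inj₁ _) = refl
      c-symmetric : ∀ x y → (c ⊎ᵇ d) x y ≡ (c ⊎ᵇ d) y x
      c-symmetric (inj₁ x) (inj₁ y) = ra.c-symmetric x y
      c-symmetric (inj₂ x) (inj₂ y) = rb.c-symmetric x y
      c-symmetric (inj₁ _) (inj₂ _) = refl
      c-symmetric (inj₂ _) (inj₁ _) = refl
      irreflexive : ∀ x → (a ⊎ᵇ b) x x ≡ false
      irreflexive (inj₁ x) = ra.irreflexive x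
      irreflexive (inj₂ x) = rb.irreflexive x
      inhabited : ∀ x → ∃ λ y → (a ⊎ᵇ b) x y ≡ true
      inhabited (inj₁ x) = let y , xy = ra.inhabited x in inj₁ y , xy
      inhabited (inj₂ x) = let y , xy = rb.inhabited x in inj₂ y , xy
      extension : ∀ x y → x ≢ y → (a ⊎ᵇ b) x y ≡ false → Common (a ⊎ᵇ b) x y ⊎ Deep (a ⊎ᵇ b) x ⊎ Deep (a ⊎ᵇ b) y
      extension (inj₁ x) _ _ _ = inj₂ (inj₁ (Deep-inj₁ (deep x)))
      extension (inj₂ _) (inj₁ y) _ _ = inj₂ (inj₂ (Deep-inj₁ (deep y)))
      extension (inj₂ x) (inj₂ y) x≢y xy with rb.extension x y (λ { refl → x≢y refl }) xy
      ... | inj₁ (p , xp , yp)   = inj₁ (inj₂ p , xp , yp)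
      ... | inj₂ (inj₁ x-deep)   = inj₂ (inj₁ (Deep-inj₂ x-deep))
      ... | inj₂ (inj₂ y-deep)   = inj₂ (inj₂ (Deep-inj₂ y-deep))
      proper : ∀ x y z → (a ⊎ᵇ b) x y ≡ true → (a ⊎ᵇ b) x z ≡ true → (c ⊎ᵇ d) x y ≡ (c ⊎ᵇ d) x z → y ≡ z
      proper (inj₁ x) (inj₁ y) (inj₁ z) xy xz eq = cong inj₁ (ra.proper x y z xy xz eq)
      proper (inj₂ x) (inj₂ y) (inj₂ z) xy xz eq = cong inj₂ (rb.proper x y z xy xz eq)

module _ {A B : Set} (φ : A → B) (ψ : B → A) (φψ : ∀ y → φ (ψ y) ≡ y) (ψφ : ∀ x → ψ (φ x) ≡ x) {b d : B → B → Bool} where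

  pull : (B → B → Bool) → A → A → Bool
  pull f x y = f (φ x) (φ y)

  private
    φ-injective : ∀ {x y} → φ x ≡ φ y → x ≡ y
    φ-injective {x} {y} eq = trans (sym (ψφ x)) (trans (cong ψ eq) (ψφ y))

    ψ-≢ : ∀ {x y} → x ≢ y → ψ x ≢ ψ y
    ψ-≢ {x} {y} x≢y eq = x≢y (trans (sym (φψ x)) (trans (cong φ eq) (φψ y)))

    φψʳ : ∀ {x y} → b x y ≡ true → b x (φ (ψ y)) ≡ true
    φψʳ {x} {y} xy = trans (cong (b x) (φψ y)) xy

    HasTwo-pull : ∀ {x} → HasTwo b (φ x) → HasTwo (pull b) x
    HasTwo-pull (p , q , p≢q , xp , xq) = ψ p , ψ q , ψ-≢ p≢q , φψʳ xp , φψʳ xq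

    Deep-pull : ∀ {x} → Deep b (φ x) → Deep (pull b) x
    Deep-pull (p , q , p≢q , (xp , p₂) , (xq , q₂)) =
      ψ p , ψ q , ψ-≢ p≢q ,
      (φψʳ xp , HasTwo-pull (subst (HasTwo b) (sym (φψ p)) p₂)) ,
      (φψʳ xq , HasTwo-pull (subst (HasTwo b) (sym (φψ q)) q₂))

  pull-rim : Rim b d → Rim (pull b) (pull d)
  pull-rim r = record
    { symmetric   = λ x y → r.symmetric (φ x) (φ y)
    ; irreflexive = λ x → r.irreflexive (φ x)
    ; inhabited   = λ x → let y , xy = r.inhabited (φ x) in ψ y , φψʳ xy
    ; extension   = extension
    ; c-symmetric = λ x y → r.c-symmetric (φ x) (φ y)
    ; proper      = λ x y z xy xz eq → φ-injective (r.proper (φ x) (φ y) (φ z) xy xz eq)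
    }
    where
    module r = Rim r
    extension : ∀ x y → x ≢ y → pull b x y ≡ false → Common (pull b) x y ⊎ Deep (pull b) x ⊎ Deep (pull b) y
    extension x y x≢y xy with r.extension (φ x) (φ y) (x≢y ∘ φ-injective) xy
    ... | inj₁ (p , xp , yp) = inj₁ (ψ p , φψʳ xp , φψʳ yp)
    ... | inj₂ (inj₁ x-deep) = inj₂ (inj₁ (Deep-pull x-deep))
    ... | inj₂ (inj₂ y-deep) = inj₂ (inj₂ (Deep-pull y-deep))

sum-split : ∀ k {m} (f : Fin (k + m) → ℕ) → sum f ≡ sum (f ∘ (_↑ˡ m)) + sum (f ∘ (k ↑ʳ_))
sum-split zero    f = refl
sum-split (suc k) f = trans (cong (f zero +_) (sum-split k (f ∘ suc))) (sym (+-assoc (f zero) _ _))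

module _ {k m} (a : Fin k → Fin k → Bool) (b : Fin m → Fin m → Bool) where

  union : Fin (k + m) → Fin (k + m) → Bool
  union x y = (a ⊎ᵇ b) (splitAt k x) (splitAt k y)

  ends-union : ends union ≡ ends a + ends b
  ends-union = trans (sum-split k _) (cong₂ _+_ (sum-cong-≗ left) (sum-cong-≗ right))
    where
    left : ∀ i → sum (λ y → ind (union (i ↑ˡ m) y)) ≡ sum (λ j → ind (a i j))
    left i = begin
      sum (λ y → ind (union (i ↑ˡ m) y))
        ≡⟨ sum-split k _ ⟩
      sum (λ j → ind (union (i ↑ˡ m) (j ↑ˡ m))) + sum (λ j → ind (union (i ↑ˡ m) (k ↑ʳ j)))
        ≡⟨ cong₂ _+_
             (sum-cong-≗ (λ j → cong₂ (λ s t → ind ((a ⊎ᵇ b) s t)) (splitAt-↑ˡ k i m) (splitAt-↑ˡ k j m)))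
             (trans (sum-cong-≗ (λ j → cong₂ (λ s t → ind ((a ⊎ᵇ b) s t)) (splitAt-↑ˡ k i m) (splitAt-↑ʳ k m j))) (sum-zero m)) ⟩
      sum (λ j → ind (a i j)) + 0
        ≡⟨ +-identityʳ _ ⟩
      sum (λ j → ind (a i j)) ∎
      where open ≡-Reasoning
    right : ∀ i → sum (λ y → ind (union (k ↑ʳ i) y)) ≡ sum (λ j → ind (b i j))
    right i = begin
      sum (λ y → ind (union (k ↑ʳ i) y))
        ≡⟨ sum-split k _ ⟩
      sum (λ j → ind (union (k ↑ʳ i) (j ↑ˡ m))) + sum (λ j → ind (union (k ↑ʳ i) (k ↑ʳ j)))
        ≡⟨ cong₂ _+_
             (trans (sum-cong-≗ (λ j → cong₂ (λ s t → ind ((a ⊎ᵇ b) s t)) (splitAt-↑ʳ k m i) (splitAt-↑ˡ k j m))) (sum-zero k))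
             (sum-cong-≗ (λ j → cong₂ (λ s t → ind ((a ⊎ᵇ b) s t)) (splitAt-↑ʳ k m i) (splitAt-↑ʳ k m j))) ⟩
      sum (λ j → ind (b i j)) ∎
      where open ≡-Reasoning

-- `size` asks for m - 1 rim edges; with the m spokes the cone has 2m - 1 edges on m + 1 vertices.
-- K2 and P3 have this size, and a cycle, having as many edges as vertices, preserves it.
record SizedRim (m : ℕ) : Set where
  field
    {a c} : Fin m → Fin m → Bool
    rim   : Rim a c
    size  : ends a + 2 ≡ 2 * m

record Cycle (k : ℕ) : Set where
  field
    {a c}   : Fin k → Fin k → Bool
    rim     : Rim a c
    deep    : ∀ x → Deep a x
    size    : ends a ≡ 2 * k
    nonedge : ∃ λ x → ∃ λ y → x ≢ y × a x y ≡ false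

K2-sized : SizedRim 2
K2-sized = record { rim = K2-rim ; size = refl }

P3-sized : SizedRim 3
P3-sized = record { rim = P3-rim ; size = refl }

C4-cycle : Cycle 4
C4-cycle = record { rim = C4-rim ; deep = from-yes (all? (Deep? (links C4-ρ C4-β))) ; size = refl ; nonedge = 0F , 2F , (λ ()) , refl }

C6-cycle : Cycle 6
C6-cycle = record { rim = C6-rim ; deep = from-yes (all? (Deep? (links C6-ρ C6-β))) ; size = refl ; nonedge = 0F , 2F , (λ ()) , refl }

NonEdge : ∀ {m} → SizedRim m → Set
NonEdge R = ∃ λ x → ∃ λ y → x ≢ y × SizedRim.a R x y ≡ false

attach : ∀ {k m} → Cycle k → SizedRim m → Σ (SizedRim (k + m)) NonEdge
attach {k} {m} C R = record { rim = pull-rim (splitAt k) (join k m) (splitAt-join k m) (join-splitAt k m) (⊎-rim C.deep C.rim R.rim) ; size = size′ } , nonedge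
  where
  module C = Cycle C
  module R = SizedRim R
  size′ : ends (union C.a R.a) + 2 ≡ 2 * (k + m)
  size′ = begin
    ends (union C.a R.a) + 2
      ≡⟨ cong (_+ 2) (trans (ends-union C.a R.a) (cong (_+ ends R.a) C.size)) ⟩
    2 * k + ends R.a + 2
      ≡⟨ +-assoc (2 * k) _ 2 ⟩
    2 * k + (ends R.a + 2)
      ≡⟨ cong (2 * k +_) R.size ⟩
    2 * k + 2 * m
      ≡⟨ *-distribˡ-+ 2 k m ⟨
    2 * (k + m) ∎
    where open ≡-Reasoning
  nonedge : ∃ λ x → ∃ λ y → x ≢ y × union C.a R.a x y ≡ false
  nonedge = let x , y , x≢y , xy = C.nonedge in
    x ↑ˡ m , y ↑ˡ m , x≢y ∘ ↑ˡ-injective m x y , trans (cong₂ (C.a ⊎ᵇ R.a) (splitAt-↑ˡ k x m) (splitAt-↑ˡ k y m)) xy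

-- The orders 6 to 9 arise as 4 + 2, 4 + 3, 6 + 2 and 6 + 3, one for each residue modulo 4.
rims : ∀ m → Σ (SizedRim (6 + m)) NonEdge
rims 0 = attach C4-cycle K2-sized
rims 1 = attach C4-cycle P3-sized
rims 2 = attach C6-cycle K2-sized
rims 3 = attach C6-cycle P3-sized
rims (suc (suc (suc (suc m)))) = attach C4-cycle (proj₁ (rims m))

-- Cones

module Cone {m} {a c : Fin m → Fin m → Bool} (rim : Rim a c) where
  open Rim rim

  cone : Graph (suc m)
  cone = record { adj = edge ; sym = edge-sym ; irrefl = edge-irr }
    where
    edge : Fin (suc m) → Fin (suc m) → Bool
    edge zero    zero    = false
    edge zero    (suc _) = true
    edge (suc _) zero    = true
    edge (suc i) (suc j) = a i j
    edge-sym : ∀ i j → edge i j ≡ edge j i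
    edge-sym zero    zero    = refl
    edge-sym zero    (suc _) = refl
    edge-sym (suc _) zero    = refl
    edge-sym (suc i) (suc j) = symmetric i j
    edge-irr : ∀ i → edge i i ≡ false
    edge-irr zero    = refl
    edge-irr (suc i) = irreflexive i

  cone-colouring : Coloring cone
  cone-colouring = record { col = k ; colSym = k-sym }
    where
    k : Fin (suc m) → Fin (suc m) → Bool
    k (suc i) (suc j) = c i j
    k _       _       = true
    k-sym : ∀ i j → k i j ≡ k j i
    k-sym zero    zero    = refl
    k-sym zero    (suc _) = refl
    k-sym (suc _) zero    = refl
    k-sym (suc i) (suc j) = c-symmetric i j

  open Colours cone-colouring

  red-unique : ∀ {x y z} → Red (suc x) (suc y) → Red (suc x) (suc z) → y ≡ z
  red-unique {x} {y} {z} xy xz with red⁻ xy | red⁻ xz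
  ... | e , k | e′ , k′ = proper x y z e e′ (trans k (sym k′))

  blue-unique : ∀ {x y z} → Blue (suc x) (suc y) → Blue (suc x) (suc z) → y ≡ z
  blue-unique {x} {y} {z} xy xz with blue⁻ xy | blue⁻ xz
  ... | e , k | e′ , k′ = proper x y z e e′ (trans k (sym k′))

  -- In a red C4 some rim vertex has both its cycle neighbours on the rim, against properness. Blue
  -- edges avoid the hub and form a matching.
  cone-critical : Critical cone-colouring
  cone-critical = critical⁺ red-free (λ {a} → blue-free {a})
    where
    red-free : NoC4 Red
    red-free {zero}  {zero}  a≢x b≢d () bx xd da
    red-free {zero}  {suc b} {zero}  a≢x b≢d ab bx xd da = a≢x refl
    red-free {zero}  {suc b} {suc x} {zero}  a≢x b≢d ab bx xd ()
    red-free {zero}  {suc b} {suc x} {suc d} a≢x b≢d ab bx xd da = b≢d (cong suc (red-unique (Red-sym {suc b} {suc x} bx) xd))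
    red-free {suc a} {zero}  {zero}  a≢x b≢d ab () xd da
    red-free {suc a} {zero}  {suc x} {zero}  a≢x b≢d ab bx xd da = b≢d refl
    red-free {suc a} {zero}  {suc x} {suc d} a≢x b≢d ab bx xd da = a≢x (cong suc (red-unique da (Red-sym {suc x} {suc d} xd)))
    red-free {suc a} {suc b} {zero}  {zero}  a≢x b≢d ab bx () da
    red-free {suc a} {suc b} {zero}  {suc d} a≢x b≢d ab bx xd da = b≢d (cong suc (red-unique ab (Red-sym {suc d} {suc a} da)))
    red-free {suc a} {suc b} {suc x} {d} a≢x b≢d ab bx xd da = a≢x (cong suc (red-unique (Red-sym {suc a} {suc b} ab) bx))
    blue-free : NoP3 Blue
    blue-free {zero}  {zero}  b≢x () ax
    blue-free {zero}  {suc b} b≢x () ax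
    blue-free {suc a} {zero}  b≢x () ax
    blue-free {suc a} {suc b} {zero}  b≢x ab ()
    blue-free {suc a} {suc b} {suc x} b≢x ab ax = b≢x (cong suc (blue-unique {a} ab ax))

  no-extension : ∀ u v (u≢v : u ≢ v) → adj cone u v ≡ false → ¬ AdmitsCritical (addEdge cone u v u≢v)
  no-extension zero    zero    u≢v _  _ = u≢v refl
  no-extension (suc x) (suc y) u≢v xy (k , crit) = by-cases (extension x y (u≢v ∘ cong suc) xy)
    where
    open Forced k crit
    hub : ∀ i → Edge zero (suc i)
    hub i = refl
    keep : ∀ {i j} → a i j ≡ true → Edge (suc i) (suc j)
    keep {i} {j} e = cong (_∨ pair (suc x) (suc y) (suc i) (suc j)) e
    new : Edge (suc x) (suc y)
    new = trans (cong (a x y ∨_) (pair⁺ (suc x) (suc y))) (∨-zeroʳ (a x y))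
    rim-red : ∀ {p} → HasTwo a p → Colours.Red k zero (suc p)
    rim-red {p} (q , r , q≢r , pq , pr) =
      hub-red {zero} {suc p} {suc q} {suc r} (q≢r ∘ suc-injective) (hub p) (hub q) (hub r) (keep pq) (keep pr)
    -- `p` and `q` have red spokes, each having two rim neighbours; so has `y`, through its old
    -- neighbour and the new edge. `x` is adjacent to all three.
    deep-⊥ : ∀ {x y} → a x y ≡ false → Edge (suc x) (suc y) → Deep a x → ⊥
    deep-⊥ {x} {y} nonedge new (p , q , p≢q , (xp , p₂) , (xq , q₂)) =
      no-three {zero} {suc x} {suc p} {suc q} {suc y} (λ ()) (p≢q ∘ suc-injective) (apart xp) (apart xq)
        (rim-red p₂) (rim-red q₂) y-red (keep xp) (keep xq) new
      where
      true≢false : ¬ true ≡ false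
      true≢false ()
      apart : ∀ {p} → a x p ≡ true → suc p ≢ suc y
      apart xp refl = true≢false (trans (sym xp) nonedge)
      y-red : Colours.Red k zero (suc y)
      y-red with inhabited y
      ... | z , yz = hub-red {zero} {suc y} {suc z} {suc x}
                       (λ { refl → true≢false (trans (sym yz) (trans (symmetric y x) nonedge)) })
                       (hub y) (hub z) (hub x) (keep yz) (Edge-sym {suc x} {suc y} new)
    by-cases : Common a x y ⊎ Deep a x ⊎ Deep a y → ⊥
    by-cases (inj₁ (p , xp , yp)) = no-K4 {zero} {suc x} {suc y} {suc p} (hub x) (hub y) (hub p) new (keep xp) (keep yp)
    by-cases (inj₂ (inj₁ x-deep)) = deep-⊥ xy new x-deep
    by-cases (inj₂ (inj₂ y-deep)) = deep-⊥ (trans (symmetric y x) xy) (Edge-sym {suc x} {suc y} new) y-deep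

  cone-size : ends a + 2 ≡ 2 * m → edgeCount cone ≡ 2 * suc m ∸ 3
  cone-size size = sym (trans (cong (_∸ 3) twice) (m+n∸n≡m e 3))
    where
    open ≡-Reasoning
    open +-*-Solver
    e = edgeCount cone
    ends-cone : ends (adj cone) ≡ m + (m + ends a)
    ends-cone = cong₂ _+_ (trans (sum-const m 1) (*-identityʳ m))
      (trans (∑-distrib-+ (λ _ → 1) (λ i → sum (ind ∘ a i))) (cong (_+ ends a) (trans (sum-const m 1) (*-identityʳ m))))
    twice : 2 * suc m ≡ e + 3
    twice = *-cancelʳ-≡ _ _ 2 (begin
      2 * suc m * 2
        ≡⟨ solve 1 (λ m → con 2 :* (con 1 :+ m) :* con 2 := m :+ (m :+ con 2 :* m) :+ con 4) refl m ⟩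
      m + (m + 2 * m) + 4
        ≡⟨ cong (λ z → m + (m + z) + 4) size ⟨
      m + (m + (ends a + 2)) + 4
        ≡⟨ solve 2 (λ m z → m :+ (m :+ (z :+ con 2)) :+ con 4 := m :+ (m :+ z) :+ con 6) refl m (ends a) ⟩
      m + (m + ends a) + 6
        ≡⟨ cong (_+ 6) (trans (sym ends-cone) (handshake cone)) ⟩
      e + e + 6
        ≡⟨ solve 1 (λ e → e :+ e :+ con 6 := (e :+ con 3) :* con 2) refl e ⟩
      (e + 3) * 2 ∎)

cone-extremal : ∀ {m} (R : SizedRim m) → NonEdge R → Σ (Graph (suc m)) λ G → CoCritical G × edgeCount G ≡ 2 * suc m ∸ 3
cone-extremal R (x , y , x≢y , xy) = cone , ((suc x , suc y , x≢y ∘ suc-injective , xy) , (cone-colouring , cone-critical) , no-extension) , cone-size (SizedRim.size R)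
  where open Cone (SizedRim.rim R)

-- Orders five and six

module _ {n} (a : Fin n → Fin n → Bool) where

  infix 4 _─_
  _─_ : Fin n → Fin n → Set
  x ─ y = a x y ≡ true

  -- Adjacencies are interleaved with the quantifiers so that the decision procedure abandons a
  -- partial choice early.
  K4 : Set
  K4 = ∃ λ h → ∃ λ x → h ─ x × ∃ λ y → h ─ y × x ─ y × ∃ λ z → h ─ z × x ─ z × y ─ z

  -- A wheel with four spokes and a triangle on one of its rim edges.
  Wheel : Set
  Wheel = ∃ λ h → ∃ λ p → h ─ p × ∃ λ q → h ─ q × p ─ q × ∃ λ r → h ─ r × q ─ r × p ≢ r ×
          ∃ λ s → h ─ s × r ─ s × s ─ p × q ≢ s × ∃ λ z → p ─ z × q ─ z × z ≢ h × z ≢ r × z ≢ s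

  infix 4 _─?_
  _─?_ : ∀ x y → Dec (x ─ y)
  x ─? y = a x y Bool.≟ true

  K4? : Dec K4
  K4? = any? λ h → any? λ x → (h ─? x) ×-dec any? λ y → (h ─? y) ×-dec (x ─? y) ×-dec any? λ z → (h ─? z) ×-dec (x ─? z) ×-dec (y ─? z)

  Wheel? : Dec Wheel
  Wheel? = any? λ h → any? λ p → (h ─? p) ×-dec any? λ q → (h ─? q) ×-dec (p ─? q) ×-dec
    any? λ r → (h ─? r) ×-dec (q ─? r) ×-dec ¬? (p ≟ r) ×-dec
    any? λ s → (h ─? s) ×-dec (r ─? s) ×-dec (s ─? p) ×-dec ¬? (q ≟ s) ×-dec
    any? λ z → (p ─? z) ×-dec (q ─? z) ×-dec ¬? (z ≟ h) ×-dec ¬? (z ≟ r) ×-dec ¬? (z ≟ s)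

obstructed : ∀ {n} (G : Graph n) → K4 (adj G) ⊎ Wheel (adj G) → ¬ AdmitsCritical G
obstructed G (inj₁ (h , x , hx , y , hy , xy , z , hz , xz , yz)) (k , crit) = Forced.no-K4 k crit hx hy hz xy xz yz
obstructed G (inj₂ (h , p , hp , q , hq , pq , r , hr , qr , p≢r , s , hs , rs , sp , q≢s , z , pz , qz , z≢h , z≢r , z≢s)) (k , crit) =
  Forced.no-wheel k crit hp hq hr hs pq qr rs sp p≢r q≢s pz qz z≢h z≢r z≢s

fromList : ∀ {n} → List (Fin n × Fin n) → Fin n → Fin n → Bool
fromList []             i j = false
fromList ((u , v) ∷ es) i j = pair u v i j ∨ fromList es i j

fromList-sym : ∀ {n} (es : List (Fin n × Fin n)) i j → fromList es i j ≡ fromList es j i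
fromList-sym []             i j = refl
fromList-sym ((u , v) ∷ es) i j = cong₂ _∨_ (pair-sym u v i j) (fromList-sym es i j)

module Small {n} (edges blues : List (Fin n × Fin n)) (loopless : ∀ i → fromList edges i i ≡ false) where

  graph : Graph n
  graph = record { adj = fromList edges ; sym = fromList-sym edges ; irrefl = loopless }

  colouring : Coloring graph
  colouring = record { col = λ i j → not (fromList blues i j) ; colSym = λ i j → cong not (fromList-sym blues i j) }

  open Colours colouring

  -- Premises stand as early as possible, again to keep the exhaustive checks short.
  RedFree BlueFree Maximal : Set
  RedFree  = ∀ a b → Red a b → ∀ x → Red b x → a ≢ x → ∀ d → Red x d → Red d a → b ≡ d
  BlueFree = ∀ a b → Blue a b → ∀ x → Blue a x → b ≡ x
  Maximal  = ∀ u v → u ≢ v → fromList edges u v ≡ false →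
             K4 (addAdj (fromList edges) u v) ⊎ Wheel (addAdj (fromList edges) u v)

  RedFree? : Dec RedFree
  RedFree? = all? λ a → all? λ b → (red a b Bool.≟ true) →-dec all? λ x → (red b x Bool.≟ true) →-dec (¬? (a ≟ x) →-dec
             all? λ d → (red x d Bool.≟ true) →-dec ((red d a Bool.≟ true) →-dec (b ≟ d)))

  BlueFree? : Dec BlueFree
  BlueFree? = all? λ a → all? λ b → (blue a b Bool.≟ true) →-dec all? λ x → (blue a x Bool.≟ true) →-dec (b ≟ x)

  Maximal? : Dec Maximal
  Maximal? = all? λ u → all? λ v → ¬? (u ≟ v) →-dec ((fromList edges u v Bool.≟ false) →-dec
             (K4? (addAdj (fromList edges) u v) ⊎-dec Wheel? (addAdj (fromList edges) u v)))

  coCritical : NonComplete graph → RedFree → BlueFree → Maximal → CoCritical graph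
  coCritical nc red-free blue-free maximal =
    nc ,
    (colouring , critical⁺
      (λ {a} {b} {x} {d} a≢x b≢d ab bx xd da → b≢d (red-free a b ab x bx a≢x d xd da))
      (λ {a} {b} {x} b≢x ab ax → b≢x (blue-free a b ab x ax))) ,
    (λ u v u≢v e → obstructed (addEdge graph u v u≢v) (maximal u v u≢v e))

-- The spine is 01 and the pages end in 2, 3, 4; joining two of these completes a K4.
book-edges book-blues : List (Fin 5 × Fin 5)
book-edges = (0F , 1F) ∷ (0F , 2F) ∷ (0F , 3F) ∷ (0F , 4F) ∷ (1F , 2F) ∷ (1F , 3F) ∷ (1F , 4F) ∷ []
book-blues = (0F , 2F) ∷ (1F , 4F) ∷ []

module Book = Small book-edges book-blues (from-yes (all? λ i → fromList book-edges i i Bool.≟ false))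

book-coCritical : CoCritical Book.graph
book-coCritical = Book.coCritical (2F , 3F , (λ ()) , refl)
  (from-yes Book.RedFree?) (from-yes Book.BlueFree?) (from-yes Book.Maximal?)

-- The outer vertices 3, 4, 5 sit on the sides of the triangle 0, 1, 2. Joining one of them to the
-- opposite corner gives a K4. Joining two gives a `Wheel`, the third outer vertex being its extra
-- triangle.
sun-edges sun-blues : List (Fin 6 × Fin 6)
sun-edges = (0F , 1F) ∷ (0F , 2F) ∷ (1F , 2F) ∷ (1F , 3F) ∷ (2F , 3F) ∷ (0F , 4F) ∷ (2F , 4F) ∷ (0F , 5F) ∷ (1F , 5F) ∷ []
sun-blues = (0F , 4F) ∷ (1F , 5F) ∷ (2F , 3F) ∷ []

module Sun = Small sun-edges sun-blues (from-yes (all? λ i → fromList sun-edges i i Bool.≟ false))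

sun-coCritical : CoCritical Sun.graph
sun-coCritical = Sun.coCritical (3F , 4F , (λ ()) , refl)
  (from-yes Sun.RedFree?) (from-yes Sun.BlueFree?) (from-yes Sun.Maximal?)

sharp : (n : ℕ) → 5 ≤ n → Σ (Graph n) λ G → CoCritical G × edgeCount G ≡ 2 * n ∸ 3
sharp 5 _ = Book.graph , book-coCritical , refl
sharp 6 _ = Sun.graph , sun-coCritical , refl
sharp (suc (suc (suc (suc (suc (suc (suc m))))))) _ = cone-extremal (proj₁ (rims m)) (proj₂ (rims m))
sharp 0 ()
sharp 1 (s≤s ())
sharp 2 (s≤s (s≤s ()))
sharp 3 (s≤s (s≤s (s≤s ())))
sharp 4 (s≤s (s≤s (s≤s (s≤s ()))))

theorem1p5 : ((n : ℕ) → 5 ≤ n → (G : Graph n) → CoCritical G → 2 * n ∸ 3 ≤ edgeCount G)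
    × ((n : ℕ) → 5 ≤ n → Σ (Graph n) λ G → CoCritical G × edgeCount G ≡ 2 * n ∸ 3)
theorem1p5 = (λ n 5≤n G co → edge-bound 5≤n G co) , sharp
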